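{- Let $A_1,A_2,A_3$ be finite subsets of $\mathbb{R}$ with $|A_1|\le |A_2|\le |A_3|$. Then \[ T^o(A_1,A_2,A_3)\lesssim |A_1|\,|A_2|^{5/3}\,|A_3|^{4/3}, \] and moreover \[ T(A_1,A_2,A_3)\lesssim |A_1|\,|A_2|^{5/3}\,|A_3|^{4/3}+|A_1|^2|A_3|^2 . \]
   Context: For finite $A_1,A_2,A_3\subseteq\mathbb{R}$, $T^o(A_1,A_2,A_3)$ is the number of triples $(u_1,u_2,u_3)$ of points of $\mathbb{R}^2$ with $u_i\in A_i\times A_i$ for $i=1,2,3$, $u_i\ne u_j$ for $i\ne j$, and $u_1,u_2,u_3$ collinear. For finite $A,B,C\subseteq\mathbb{R}$, $T(A,B,C)=\#\{(a_1,a_2,b_1,b_2,c_1,c_2)\in A^2\times B^2\times C^2:\ (b_1-a_1)(c_2-a_2)=(c_1-a_1)(b_2-a_2)\}$. Notation: $X\lesssim Y$ means $X\le C\,Y(\log(2+N))^{c}$ for some absolute constants $C,c>0$, where $N$ is the largest cardinality of the finite sets in the statement; $X\gtrsim Y$ means $Y\lesssim X$. -}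

module Defs where

open import Data.List.Base using (List; length)
open import Data.List.Relation.Unary.All using (All)
import Data.List.Membership.Setoid as Membership
import Data.List.Relation.Unary.Unique.Setoid as Uniqueness
open import Data.Nat.Base as ℕ using (ℕ)
import Data.Nat.Properties as ℕ
open import Data.Nat.Logarithm using (⌊log₂_⌋)
open import Data.Product.Base using (_×_; _,_; ∃-syntax)
open import Data.Product.Relation.Binary.Pointwise.NonDependent using (×-setoid)
open import Data.Rational.Base as ℚ using (ℚ; 0ℚ; 1ℚ; ½)
import Data.Rational.Properties as ℚ
open import Data.Rational.Solver using (module +-*-Solver)
open import Level using (0ℓ)
open import Relation.Binary.Bundles using (Setoid)
open import Relation.Binary.PropositionalEquality
  using (_≡_; refl; sym; trans; cong; subst)
open import Relation.Nullary.Negation using (¬_)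

triangle : ∀ p q r → ℚ.∣ p ℚ.- r ∣ ℚ.≤ ℚ.∣ p ℚ.- q ∣ ℚ.+ ℚ.∣ q ℚ.- r ∣
triangle p q r = subst (λ s → ℚ.∣ s ∣ ℚ.≤ ℚ.∣ p ℚ.- q ∣ ℚ.+ ℚ.∣ q ℚ.- r ∣)
  (solve 3 (λ p q r → (p :- q) :+ (q :- r) := p :- r) refl p q r)
  (ℚ.∣p+q∣≤∣p∣+∣q∣ (p ℚ.- q) (q ℚ.- r))
  where open +-*-Solver

dist-sym : ∀ p q → ℚ.∣ p ℚ.- q ∣ ≡ ℚ.∣ q ℚ.- p ∣
dist-sym p q = trans (sym (ℚ.∣-p∣≡∣p∣ (p ℚ.- q)))
  (cong ℚ.∣_∣ (solve 2 (λ p q → :- (p :- q) := q :- p) refl p q))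
  where open +-*-Solver

dist-refl : ∀ p → ℚ.∣ p ℚ.- p ∣ ≡ 0ℚ
dist-refl p = cong ℚ.∣_∣ (ℚ.+-inverseʳ p)

half-pos : ∀ {ε} → 0ℚ ℚ.< ε → 0ℚ ℚ.< ½ ℚ.* ε
half-pos {ε} 0<ε = ℚ.positive⁻¹ _ {{ℚ.pos*pos⇒pos ½ ε {{ℚ.positive 0<ε}}}}

halves : ∀ {p q ε} → p ℚ.< ½ ℚ.* ε → q ℚ.< ½ ℚ.* ε → p ℚ.+ q ℚ.< ε
halves {p} {q} {ε} p< q< = subst (p ℚ.+ q ℚ.<_)
  (trans (sym (ℚ.*-distribʳ-+ ε ½ ½)) (ℚ.*-identityˡ ε)) (ℚ.+-mono-< p< q<)

IsCauchy : (ℕ → ℚ) → Set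
IsCauchy s = ∀ ε → 0ℚ ℚ.< ε →
  ∃[ N ] (∀ m n → N ℕ.≤ m → N ℕ.≤ n → ℚ.∣ s m ℚ.- s n ∣ ℚ.< ε)

-- The real numbers, as Cauchy sequences of rationals.  Two sequences represent
-- the same real when related by _≈_ below, so every notion of equality,
-- membership and counting refers to _≈_ and never to _≡_.
record ℝ : Set where
  constructor mkℝ
  field
    seq    : ℕ → ℚ
    cauchy : IsCauchy seq

open ℝ public

infix 4 _≈_
infixl 6 _+_ _-_
infixl 7 _*_

_≈_ : ℝ → ℝ → Set
x ≈ y = ∀ ε → 0ℚ ℚ.< ε → ∃[ N ] (∀ n → N ℕ.≤ n → ℚ.∣ seq x n ℚ.- seq y n ∣ ℚ.< ε)

ℝ-setoid : Setoid 0ℓ 0ℓ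
ℝ-setoid = record
  { Carrier = ℝ
  ; _≈_ = _≈_
  ; isEquivalence = record
    { refl = λ {x} ε 0<ε → 0 , λ n _ → subst (ℚ._< ε) (sym (dist-refl (seq x n))) 0<ε
    ; sym = λ {x} {y} x≈y ε 0<ε → let (N , h) = x≈y ε 0<ε in
        N , λ n N≤n → subst (ℚ._< ε) (dist-sym (seq x n) (seq y n)) (h n N≤n)
    ; trans = λ {x} {y} {z} x≈y y≈z ε 0<ε →
        let (M , f) = x≈y (½ ℚ.* ε) (half-pos 0<ε)
            (N , g) = y≈z (½ ℚ.* ε) (half-pos 0<ε)
        in M ℕ.⊔ N , λ n le → ℚ.≤-<-trans (triangle (seq x n) (seq y n) (seq z n))
             (halves (f n (ℕ.m⊔n≤o⇒m≤o M N le)) (g n (ℕ.m⊔n≤o⇒n≤o M N le)))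
    }
  }

0ℝ : ℝ
0ℝ = mkℝ (λ _ → 0ℚ) λ ε 0<ε → 0 , λ _ _ _ _ → 0<ε

_+_ : ℝ → ℝ → ℝ
x + y = mkℝ (λ n → seq x n ℚ.+ seq y n) λ ε 0<ε →
  let (M , f) = cauchy x (½ ℚ.* ε) (half-pos 0<ε)
      (N , g) = cauchy y (½ ℚ.* ε) (half-pos 0<ε)
  in M ℕ.⊔ N , λ m n M⊔N≤m M⊔N≤n →
    ℚ.≤-<-trans
      (subst (λ s → ℚ.∣ s ∣ ℚ.≤ ℚ.∣ seq x m ℚ.- seq x n ∣ ℚ.+ ℚ.∣ seq y m ℚ.- seq y n ∣)
        (solve 4 (λ a b c d → (a :- b) :+ (c :- d) := (a :+ c) :- (b :+ d)) refl
          (seq x m) (seq x n) (seq y m) (seq y n))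
        (ℚ.∣p+q∣≤∣p∣+∣q∣ (seq x m ℚ.- seq x n) (seq y m ℚ.- seq y n)))
      (halves (f m n (ℕ.m⊔n≤o⇒m≤o M N M⊔N≤m) (ℕ.m⊔n≤o⇒m≤o M N M⊔N≤n))
              (g m n (ℕ.m⊔n≤o⇒n≤o M N M⊔N≤m) (ℕ.m⊔n≤o⇒n≤o M N M⊔N≤n)))
  where open +-*-Solver

-_ : ℝ → ℝ
- x = mkℝ (λ n → ℚ.- seq x n) λ ε 0<ε →
  let (N , f) = cauchy x ε 0<ε
  in N , λ m n N≤m N≤n → subst (ℚ._< ε)
       (trans (dist-sym (seq x m) (seq x n))
         (cong ℚ.∣_∣ (solve 2 (λ a b → b :- a := (:- a) :- (:- b)) refl (seq x m) (seq x n))))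
       (f m n N≤m N≤n)
  where open +-*-Solver

_-_ : ℝ → ℝ → ℝ
x - y = x + (- y)

eventuallyBounded : ∀ x → ∃[ B ] ∃[ N ]
  (0ℚ ℚ.< B × (∀ n → N ℕ.≤ n → ℚ.∣ seq x n ∣ ℚ.≤ B))
eventuallyBounded x =
  let (N , f) = cauchy x 1ℚ (ℚ.positive⁻¹ 1ℚ)
      xN = seq x N
  in 1ℚ ℚ.+ ℚ.∣ xN ∣ , N ,
     ℚ.+-mono-<-≤ (ℚ.positive⁻¹ 1ℚ) (ℚ.0≤∣p∣ xN) ,
     λ n N≤n → ℚ.≤-trans
       (subst (λ s → ℚ.∣ s ∣ ℚ.≤ ℚ.∣ seq x n ℚ.- xN ∣ ℚ.+ ℚ.∣ xN ∣)
         (solve 2 (λ a b → (a :- b) :+ b := a) refl (seq x n) xN)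
         (ℚ.∣p+q∣≤∣p∣+∣q∣ (seq x n ℚ.- xN) xN))
       (ℚ.+-monoˡ-≤ ℚ.∣ xN ∣ (ℚ.<⇒≤ (f n N N≤n ℕ.≤-refl)))
  where open +-*-Solver

*-small : ∀ a b {B δ} → 0ℚ ℚ.< B → ℚ.∣ a ∣ ℚ.≤ B → ℚ.∣ b ∣ ℚ.< δ →
          ℚ.∣ a ℚ.* b ∣ ℚ.< B ℚ.* δ
*-small a b {B} {δ} 0<B a≤B b<δ = begin-strict
  ℚ.∣ a ℚ.* b ∣         ≡⟨ ℚ.∣p*q∣≡∣p∣*∣q∣ a b ⟩
  ℚ.∣ a ∣ ℚ.* ℚ.∣ b ∣   ≤⟨ ℚ.*-monoʳ-≤-nonNeg ℚ.∣ b ∣ {{ℚ.nonNegative (ℚ.0≤∣p∣ b)}} a≤B ⟩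
  B ℚ.* ℚ.∣ b ∣         <⟨ ℚ.*-monoʳ-<-pos B {{ℚ.positive 0<B}} b<δ ⟩
  B ℚ.* δ               ∎
  where open ℚ.≤-Reasoning

split : ∀ S ε → 0ℚ ℚ.< S → 0ℚ ℚ.< ε → ∃[ δ ] (0ℚ ℚ.< δ × S ℚ.* δ ≡ ε)
split S ε 0<S 0<ε =
  S⁻¹ ℚ.* ε ,
  ℚ.positive⁻¹ _ {{ℚ.pos*pos⇒pos S⁻¹ {{ℚ.1/pos⇒pos S {{S>0}}}} ε {{ℚ.positive 0<ε}}}} ,
  trans (sym (ℚ.*-assoc S S⁻¹ ε))
    (trans (cong (ℚ._* ε) (ℚ.*-inverseʳ S {{S≢0}})) (ℚ.*-identityˡ ε))
  where
  S>0 : ℚ.Positive S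
  S>0 = ℚ.positive 0<S
  S≢0 : ℚ.NonZero S
  S≢0 = ℚ.pos⇒nonZero S {{S>0}}
  S⁻¹ : ℚ
  S⁻¹ = ℚ.1/_ S {{S≢0}}

*-dist : ∀ a b c d {B D δ} → 0ℚ ℚ.< B → 0ℚ ℚ.< D →
         ℚ.∣ a ∣ ℚ.≤ B → ℚ.∣ d ∣ ℚ.≤ D →
         ℚ.∣ c ℚ.- d ∣ ℚ.< δ → ℚ.∣ a ℚ.- b ∣ ℚ.< δ →
         ℚ.∣ a ℚ.* c ℚ.- b ℚ.* d ∣ ℚ.< (B ℚ.+ D) ℚ.* δ
*-dist a b c d {B} {D} {δ} 0<B 0<D a≤B d≤D c-d<δ a-b<δ = begin-strict
  ℚ.∣ a ℚ.* c ℚ.- b ℚ.* d ∣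
    ≡⟨ cong ℚ.∣_∣ (solve 4 (λ a b c d →
         a :* c :- b :* d := a :* (c :- d) :+ d :* (a :- b)) refl a b c d) ⟩
  ℚ.∣ a ℚ.* (c ℚ.- d) ℚ.+ d ℚ.* (a ℚ.- b) ∣
    ≤⟨ ℚ.∣p+q∣≤∣p∣+∣q∣ (a ℚ.* (c ℚ.- d)) (d ℚ.* (a ℚ.- b)) ⟩
  ℚ.∣ a ℚ.* (c ℚ.- d) ∣ ℚ.+ ℚ.∣ d ℚ.* (a ℚ.- b) ∣
    <⟨ ℚ.+-mono-< (*-small a (c ℚ.- d) 0<B a≤B c-d<δ) (*-small d (a ℚ.- b) 0<D d≤D a-b<δ) ⟩
  B ℚ.* δ ℚ.+ D ℚ.* δ
    ≡⟨ ℚ.*-distribʳ-+ δ B D ⟨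
  (B ℚ.+ D) ℚ.* δ ∎
  where
  open +-*-Solver
  open ℚ.≤-Reasoning

*-cauchy : ∀ x y → IsCauchy (λ n → seq x n ℚ.* seq y n)
*-cauchy x y ε 0<ε =
  let (B , K , 0<B , bx) = eventuallyBounded x
      (D , L , 0<D , by) = eventuallyBounded y
      (δ , 0<δ , total)  = split (B ℚ.+ D) ε (ℚ.+-mono-< 0<B 0<D) 0<ε
      (M , f) = cauchy x δ 0<δ
      (N , g) = cauchy y δ 0<δ
  in (K ℕ.⊔ L) ℕ.⊔ (M ℕ.⊔ N) , λ m n P≤m P≤n →
    let KL≤m = ℕ.m⊔n≤o⇒m≤o (K ℕ.⊔ L) (M ℕ.⊔ N) P≤m
        KL≤n = ℕ.m⊔n≤o⇒m≤o (K ℕ.⊔ L) (M ℕ.⊔ N) P≤n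
        MN≤m = ℕ.m⊔n≤o⇒n≤o (K ℕ.⊔ L) (M ℕ.⊔ N) P≤m
        MN≤n = ℕ.m⊔n≤o⇒n≤o (K ℕ.⊔ L) (M ℕ.⊔ N) P≤n
    in subst (ℚ.∣ seq x m ℚ.* seq y m ℚ.- seq x n ℚ.* seq y n ∣ ℚ.<_) total
         (*-dist (seq x m) (seq x n) (seq y m) (seq y n) 0<B 0<D
           (bx m (ℕ.m⊔n≤o⇒m≤o K L KL≤m)) (by n (ℕ.m⊔n≤o⇒n≤o K L KL≤n))
           (g m n (ℕ.m⊔n≤o⇒n≤o M N MN≤m) (ℕ.m⊔n≤o⇒n≤o M N MN≤n))
           (f m n (ℕ.m⊔n≤o⇒m≤o M N MN≤m) (ℕ.m⊔n≤o⇒m≤o M N MN≤n)))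

_*_ : ℝ → ℝ → ℝ
x * y = mkℝ (λ n → seq x n ℚ.* seq y n) (*-cauchy x y)

open Membership ℝ-setoid public using (_∈_)
open Uniqueness ℝ-setoid using (Unique)

record FiniteSet : Set where
  constructor mkFiniteSet
  field
    elements : List ℝ
    distinct : Unique elements

open FiniteSet public

∣_∣ : FiniteSet → ℕ
∣ A ∣ = length (elements A)

Point : Set
Point = ℝ × ℝ

Point-setoid : Setoid 0ℓ 0ℓ
Point-setoid = ×-setoid ℝ-setoid ℝ-setoid

infix 4 _≉ₚ_ _∈²_

_≉ₚ_ : Point → Point → Set
p ≉ₚ q = ¬ Setoid._≈_ Point-setoid p q

_∈²_ : Point → FiniteSet → Set
(x , y) ∈² A = x ∈ elements A × y ∈ elements A

record Line : Set where
  field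
    α β γ         : ℝ
    nondegenerate : ¬ (α ≈ 0ℝ × β ≈ 0ℝ)

_liesOn_ : Point → Line → Set
(x , y) liesOn ℓ = α * x + β * y ≈ γ
  where open Line ℓ

Collinear : Point → Point → Point → Set
Collinear p q r = ∃[ ℓ ] (p liesOn ℓ × q liesOn ℓ × r liesOn ℓ)

Triple : Set
Triple = Point × Point × Point

Triple-setoid : Setoid 0ℓ 0ℓ
Triple-setoid = ×-setoid Point-setoid (×-setoid Point-setoid Point-setoid)

ProperCollinear : FiniteSet → FiniteSet → FiniteSet → Triple → Set
ProperCollinear A₁ A₂ A₃ (u₁ , u₂ , u₃) =
  (u₁ ∈² A₁ × u₂ ∈² A₂ × u₃ ∈² A₃) ×
  (u₁ ≉ₚ u₂ × u₁ ≉ₚ u₃ × u₂ ≉ₚ u₃) ×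
  Collinear u₁ u₂ u₃

-- A sextuple (a₁,a₂,b₁,b₂,c₁,c₂) is grouped as ((a₁,a₂),(b₁,b₂),(c₁,c₂)).
Solution : FiniteSet → FiniteSet → FiniteSet → Triple → Set
Solution A B C ((a₁ , a₂) , (b₁ , b₂) , (c₁ , c₂)) =
  ((a₁ , a₂) ∈² A × (b₁ , b₂) ∈² B × (c₁ , c₂) ∈² C) ×
  (b₁ - a₁) * (c₂ - a₂) ≈ (c₁ - a₁) * (b₂ - a₂)

-- t ≤# P means t ≤ #P: there are t distinct triples satisfying P.  Equality
-- of reals is undecidable, so #P is not a computable number; "#P ≤ Z" is
-- stated as "every t ≤# P is ≤ Z".
infix 4 _≤#_

_≤#_ : ℕ → (Triple → Set) → Set
t ≤# P = ∃[ us ] (Uniqueness.Unique Triple-setoid us × All P us × length us ≡ t)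

-- t ≤ K · (D^(1/3) + E), written without roots: for natural numbers this is
-- t - K·E ≤ K · D^(1/3), which always holds when t ≤ K·E and otherwise is
-- equivalent to the inequality of cubes.
_≤_·[∛_+_] : ℕ → ℕ → ℕ → ℕ → Set
t ≤ K ·[∛ D + E ] = (t ℕ.∸ K ℕ.* E) ℕ.^ 3 ℕ.≤ K ℕ.^ 3 ℕ.* D

-- #P ≤ C · (log (2 + N))^c · (D^(1/3) + E).  The logarithm is ⌊log₂_⌋: since
-- 2 + N ≥ 2, it lies within constant factors of the natural logarithm, and C
-- and c are only ever existentially quantified.
Bounded : (C c N D E : ℕ) → (Triple → Set) → Set
Bounded C c N D E P =
  ∀ t → t ≤# P → t ≤ C ℕ.* ⌊log₂ (2 ℕ.+ N) ⌋ ℕ.^ c ·[∛ D + E ]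

{-# OPTIONS --safe #-}

-- Let a line ℓ contain i points of an n × n grid.  Cut the grid into cells of
-- m × m points.  As ℓ is monotone, it meets at most 2n/m + 1 cells, so for
-- m ≈ n/i it carries about i pairs of points sharing a cell.  Distinct lines carry
-- distinct pairs and there are only (nm)² pairs sharing a cell, so dyadic summation
-- over m gives ∑ i³ ≲ n⁴ over all lines with i ≥ 2.  This replaces the
-- Szemerédi–Trotter theorem.
--
-- For lines meeting the three grids in i₁, i₂, i₃ points, let p ≤ i₁i₂ be the
-- number of pairs of distinct points in the first two grids; then ∑ p ≤ |A₁|²|A₂|²
-- and the number of triples is at most ∑ p i₃.  Lines with i₃ ≤ 1 contribute ∑ p;
-- lines rich in all three grids are handled by (∑ i₁i₂i₃)³ ≤ ∏ ∑ iⱼ³; the others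
-- by (∑ p i₃)³ ≤ (∑ i₃³)(∑ p)(∑ p²) together with (∑ p²)² ≤ (∑ p)(∑ p³).
--
-- The claimed inequalities between natural numbers are decidable, so that
-- finitely many questions about the reals involved may be decided classically.
module Submission where

-- Finite sums, counting and Hölder's inequality

-- The obstacle is that cube sums say nothing about lines with a single point in a grid: any number
-- of lines may pass through one point. Such lines are controlled only through p, which charges a
-- line to pairs of distinct points that no other line contains. Let a ≤ b ≤ c be the sizes of the
-- three sets. If a line has at most one point in the first or the second grid, then p is at most
-- its number of points in the other one, so p³ is at most p plus those of i₁³, i₂³ with iⱼ ≥ 2, and
-- ∑ p³ ≲ b⁴ over these lines. Hence (∑ p²)² ≲ a²b² · b⁴, and the mixed term is c⁴ · a²b² · ab³ =
-- a³b⁵c⁴, exactly the cube of the claimed bound. The other two terms, a⁶b⁶ and a⁴b⁴c⁴, are no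
-- larger because a ≤ b ≤ c. The counting uses two facts about lines: they are monotone, and two
-- distinct points lie on at most one of them. So reals are replaced by their ranks and everything
-- is counted on `Fin n × Fin n`. Roots never occur: the inequalities compare squares or cubes of
-- natural numbers.

module FiniteSums where
  open import Data.Nat.Base using (ℕ; _+_; _*_; _≤_; _<_; z≤n; s≤s)
  open import Data.Nat.Properties renaming (_≟_ to _≟ℕ_)
  open import Data.Nat.ListAction using (sum)
  open import Data.Nat.Tactic.RingSolver using (solve-∀)
  open import Data.List.Base using (List; []; _∷_; _++_; map; length; cartesianProduct; upTo)
  open import Data.List.Properties using (length-++; length-map; length-upTo)
  open import Data.List.Membership.Propositional using (_∈_; find)
  open import Data.List.Membership.Propositional.Properties
    using (∈-upTo⁺; ∈-∃++; ∈-++⁻; ∈-++⁺ˡ; ∈-++⁺ʳ)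
  open import Data.List.Relation.Unary.All as All using (All; []; _∷_)
  open import Data.List.Relation.Unary.Any using (Any; here; there; any?)
  open import Data.List.Relation.Unary.AllPairs as AllPairs using (AllPairs; []; _∷_)
  open import Data.List.Relation.Unary.Unique.Propositional using (Unique)
  import Data.List.Relation.Unary.Unique.Propositional.Properties as Unique
  open import Data.Product.Base using (_×_; _,_)
  open import Data.Sum.Base using (inj₁; inj₂)
  open import Function.Base using (_∘_)
  open import Relation.Binary.Definitions using (DecidableEquality)
  open import Relation.Binary.PropositionalEquality
    using (_≡_; _≢_; refl; sym; trans; cong; cong₂; subst; subst₂)
  open import Relation.Nullary.Decidable using (Dec; yes; no; _×-dec_; ¬?)
  open import Relation.Nullary.Negation using (¬_; contradiction)
  open import Level using (0ℓ)
  open import Relation.Unary using (Pred; Decidable)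

  private
    variable
      X Y : Set

  ∑ : List X → (X → ℕ) → ℕ
  ∑ xs f = sum (map f xs)

  infixr 8 ∑
  syntax ∑ xs (λ x → e) = ∑[ x ∈ xs ] e

  𝟙 : {P : Set} → Dec P → ℕ
  𝟙 (yes _) = 1
  𝟙 (no _)  = 0

  𝟙≤1 : {P : Set} (P? : Dec P) → 𝟙 P? ≤ 1
  𝟙≤1 (yes _) = ≤-refl
  𝟙≤1 (no _)  = z≤n

  𝟙-yes : {P : Set} (P? : Dec P) → P → 𝟙 P? ≡ 1
  𝟙-yes (yes _) _ = refl
  𝟙-yes (no ¬p) p = contradiction p ¬p

  𝟙-no : {P : Set} (P? : Dec P) → ¬ P → 𝟙 P? ≡ 0
  𝟙-no (yes p) ¬p = contradiction p ¬p
  𝟙-no (no _)  _  = refl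

  𝟙-mono : {P Q : Set} (P? : Dec P) (Q? : Dec Q) → (P → Q) → 𝟙 P? ≤ 𝟙 Q?
  𝟙-mono (yes p) Q? f = ≤-reflexive (sym (𝟙-yes Q? (f p)))
  𝟙-mono (no _)  Q? f = z≤n

  𝟙-× : {P Q : Set} (P? : Dec P) (Q? : Dec Q) → 𝟙 (P? ×-dec Q?) ≡ 𝟙 P? * 𝟙 Q?
  𝟙-× (yes _) (yes _) = refl
  𝟙-× (yes _) (no _)  = refl
  𝟙-× (no _)  (yes _) = refl
  𝟙-× (no _)  (no _)  = refl

  ∑-mono : ∀ (xs : List X) {f g : X → ℕ} → (∀ x → f x ≤ g x) → ∑ xs f ≤ ∑ xs g
  ∑-mono []       f≤g = z≤n
  ∑-mono (x ∷ xs) f≤g = +-mono-≤ (f≤g x) (∑-mono xs f≤g)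

  ∑-cong : ∀ (xs : List X) {f g : X → ℕ} → (∀ x → f x ≡ g x) → ∑ xs f ≡ ∑ xs g
  ∑-cong []       f≡g = refl
  ∑-cong (x ∷ xs) f≡g = cong₂ _+_ (f≡g x) (∑-cong xs f≡g)

  ∑-+ : ∀ (xs : List X) (f g : X → ℕ) → ∑[ x ∈ xs ] (f x + g x) ≡ ∑ xs f + ∑ xs g
  ∑-+ []       f g = refl
  ∑-+ (x ∷ xs) f g = trans (cong (f x + g x +_) (∑-+ xs f g))
    (interchange (f x) (g x) (∑ xs f) (∑ xs g))
    where
    interchange : ∀ a b c d → a + b + (c + d) ≡ a + c + (b + d)
    interchange = solve-∀

  ∑-*ˡ : ∀ (xs : List X) c (f : X → ℕ) → ∑[ x ∈ xs ] (c * f x) ≡ c * ∑ xs f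
  ∑-*ˡ []       c f = sym (*-zeroʳ c)
  ∑-*ˡ (x ∷ xs) c f = trans (cong (c * f x +_) (∑-*ˡ xs c f)) (sym (*-distribˡ-+ c (f x) _))

  ∑-*ʳ : ∀ (xs : List X) (f : X → ℕ) c → ∑[ x ∈ xs ] (f x * c) ≡ ∑ xs f * c
  ∑-*ʳ xs f c = trans (∑-cong xs (λ x → *-comm (f x) c))
    (trans (∑-*ˡ xs c f) (*-comm c _))

  ∑-const : ∀ (xs : List X) c → ∑[ _ ∈ xs ] c ≡ length xs * c
  ∑-const []       c = refl
  ∑-const (x ∷ xs) c = cong (c +_) (∑-const xs c)

  ∑-zero : ∀ (xs : List X) → ∑[ _ ∈ xs ] 0 ≡ 0
  ∑-zero xs = trans (∑-const xs 0) (*-zeroʳ (length xs))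

  ∑-swap : ∀ (xs : List X) (ys : List Y) (f : X → Y → ℕ) →
           ∑[ x ∈ xs ] ∑[ y ∈ ys ] f x y ≡ ∑[ y ∈ ys ] ∑[ x ∈ xs ] f x y
  ∑-swap []       ys f = sym (∑-zero ys)
  ∑-swap (x ∷ xs) ys f = trans (cong (∑ ys (f x) +_) (∑-swap xs ys f))
    (sym (∑-+ ys (f x) (λ y → ∑[ x ∈ xs ] f x y)))

  ∑-++ : ∀ (xs ys : List X) (f : X → ℕ) → ∑ (xs ++ ys) f ≡ ∑ xs f + ∑ ys f
  ∑-++ []       ys f = refl
  ∑-++ (x ∷ xs) ys f = trans (cong (f x +_) (∑-++ xs ys f)) (sym (+-assoc (f x) _ _))

  ∑-map : ∀ (g : X → Y) xs (f : Y → ℕ) → ∑ (map g xs) f ≡ ∑ xs (f ∘ g)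
  ∑-map g []       f = refl
  ∑-map g (x ∷ xs) f = cong (f (g x) +_) (∑-map g xs f)

  ∑-cartesianProduct : ∀ (xs : List X) (ys : List Y) (f : X × Y → ℕ) →
                       ∑ (cartesianProduct xs ys) f ≡ ∑[ x ∈ xs ] ∑[ y ∈ ys ] f (x , y)
  ∑-cartesianProduct []       ys f = refl
  ∑-cartesianProduct (x ∷ xs) ys f =
    trans (∑-++ (map (x ,_) ys) (cartesianProduct xs ys) f)
      (cong₂ _+_ (∑-map (x ,_) ys f) (∑-cartesianProduct xs ys f))

  ∑-product : ∀ (xs : List X) (ys : List Y) (f : X → ℕ) (g : Y → ℕ) →
              ∑[ x ∈ xs ] ∑[ y ∈ ys ] (f x * g y) ≡ ∑ xs f * ∑ ys g
  ∑-product xs ys f g = trans (∑-cong xs (λ x → ∑-*ˡ ys (f x) g)) (∑-*ʳ xs f (∑ ys g))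

  ∈⇒≤∑ : ∀ {xs : List X} {x} (f : X → ℕ) → x ∈ xs → f x ≤ ∑ xs f
  ∈⇒≤∑ {xs = x ∷ xs} f (here refl) = m≤m+n (f x) (∑ xs f)
  ∈⇒≤∑ {xs = x ∷ xs} f (there p)   = ≤-trans (∈⇒≤∑ f p) (m≤n+m (∑ xs f) (f x))

  ∑-⊆ : ∀ {xs ys : List X} (f : X → ℕ) → Unique xs → (∀ {x} → x ∈ xs → x ∈ ys) →
        ∑ xs f ≤ ∑ ys f
  ∑-⊆ {xs = []} f _ _ = z≤n
  ∑-⊆ {xs = x ∷ xs} f (x∉xs ∷ u) xs⊆ys with ∈-∃++ (xs⊆ys (here refl))
  ... | as , bs , refl = begin
    f x + ∑ xs f            ≤⟨ +-monoʳ-≤ (f x) (∑-⊆ f u xs⊆as++bs) ⟩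
    f x + ∑ (as ++ bs) f    ≡⟨ cong (f x +_) (∑-++ as bs f) ⟩
    f x + (∑ as f + ∑ bs f) ≡⟨ shuffle (f x) (∑ as f) (∑ bs f) ⟩
    ∑ as f + (f x + ∑ bs f) ≡⟨ ∑-++ as (x ∷ bs) f ⟨
    ∑ (as ++ x ∷ bs) f      ∎
    where
    open ≤-Reasoning
    shuffle : ∀ a b c → a + (b + c) ≡ b + (a + c)
    shuffle = solve-∀
    xs⊆as++bs : ∀ {z} → z ∈ xs → z ∈ as ++ bs
    xs⊆as++bs z∈xs with ∈-++⁻ as (xs⊆ys (there z∈xs))
    ... | inj₁ z∈as         = ∈-++⁺ˡ z∈as
    ... | inj₂ (here refl)  = contradiction refl (All.lookup x∉xs z∈xs)
    ... | inj₂ (there z∈bs) = ∈-++⁺ʳ as z∈bs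

  -- Exclusiveness is asked of the pairs of the list rather than of equality of its entries, so that
  -- lists of lines, which have no decidable equality, are covered too.
  ∑-𝟙≤1 : ∀ {P : Pred X 0ℓ} (P? : Decidable P) {xs} →
          AllPairs (λ x y → P x → ¬ P y) xs → ∑[ x ∈ xs ] 𝟙 (P? x) ≤ 1
  ∑-𝟙≤1 P? [] = z≤n
  ∑-𝟙≤1 {P = P} P? {x ∷ xs} (h ∷ hs) with P? x
  ... | no _  = ∑-𝟙≤1 P? hs
  ... | yes p = s≤s (≤-reflexive (none h))
    where
    none : ∀ {ys} → All (λ y → P x → ¬ P y) ys → ∑[ y ∈ ys ] 𝟙 (P? y) ≡ 0
    none []               = refl
    none (_∷_ {y} hy hys) = cong₂ _+_ (𝟙-no (P? y) (hy p)) (none hys)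

  module _ (_≟_ : DecidableEquality X) {P : Pred X 0ℓ} (P? : Decidable P) where

    offDiagonal : X → X → ℕ
    offDiagonal x y = 𝟙 (P? x ×-dec P? y ×-dec ¬? (x ≟ y))

    -- Fix one element `x₀` with `P`: every other one forms an off-diagonal pair with it. The row of
    -- `x₀` alone already suffices.
    count≤1+offDiagonal : ∀ {xs} → Unique xs →
      ∑[ x ∈ xs ] 𝟙 (P? x) ≤ 1 + ∑[ x ∈ xs ] ∑[ y ∈ xs ] offDiagonal x y
    count≤1+offDiagonal {xs} u with any? P? xs
    ... | no ¬any = ≤-trans (≤-reflexive (none xs ¬any)) z≤n
      where
      none : ∀ ys → ¬ Any P ys → ∑[ y ∈ ys ] 𝟙 (P? y) ≡ 0
      none []       _    = refl
      none (y ∷ ys) ¬any = cong₂ _+_ (𝟙-no (P? y) (¬any ∘ here)) (none ys (¬any ∘ there))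
    ... | yes any with find any
    ... | x₀ , x₀∈xs , px₀ = begin
      ∑[ y ∈ xs ] 𝟙 (P? y)
        ≤⟨ ∑-mono xs pointwise ⟩
      ∑[ y ∈ xs ] (𝟙 (x₀ ≟ y) + offDiagonal x₀ y)
        ≡⟨ ∑-+ xs _ _ ⟩
      (∑[ y ∈ xs ] 𝟙 (x₀ ≟ y)) + (∑[ y ∈ xs ] offDiagonal x₀ y)
        ≤⟨ +-mono-≤ (∑-𝟙≤1 (x₀ ≟_) (AllPairs.map (λ x≢y p q → x≢y (trans (sym p) q)) u))
                    (∈⇒≤∑ (λ x → ∑[ y ∈ xs ] offDiagonal x y) x₀∈xs) ⟩
      1 + ∑[ x ∈ xs ] ∑[ y ∈ xs ] offDiagonal x y ∎
      where
      open ≤-Reasoning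
      pointwise : ∀ y → 𝟙 (P? y) ≤ 𝟙 (x₀ ≟ y) + offDiagonal x₀ y
      pointwise y with x₀ ≟ y
      ... | yes _ = ≤-trans (𝟙≤1 (P? y)) (s≤s z≤n)
      ... | no x₀≢y = 𝟙-mono (P? y) _ (λ py → px₀ , py , x₀≢y)

  length≤∑ : ∀ {X : Set} {f : X → ℕ} {xs} → All (λ x → 1 ≤ f x) xs → length xs ≤ ∑ xs f
  length≤∑ []       = z≤n
  length≤∑ (h ∷ hs) = +-mono-≤ h (length≤∑ hs)

  ∑-𝟙≤𝟙 : ∀ {P : Pred X 0ℓ} {Q : Set} (P? : Decidable P) (Q? : Dec Q) {xs} →
          (∀ x → P x → Q) → AllPairs (λ x y → P x → ¬ P y) xs →
          ∑[ x ∈ xs ] 𝟙 (P? x) ≤ 𝟙 Q?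
  ∑-𝟙≤𝟙 P? (yes _)      P⇒Q h = ∑-𝟙≤1 P? h
  ∑-𝟙≤𝟙 P? (no ¬q) {xs} P⇒Q h = ≤-reflexive
    (trans (∑-cong xs (λ x → 𝟙-no (P? x) (¬q ∘ P⇒Q x))) (∑-zero xs))

  -- Pigeonhole: each of the `K` fibres of `κ` gets one element for free, the others are paid for by
  -- pairs inside the fibre, and a pair lies in one fibre only.
  count≤collisions+values :
    ∀ (_≟_ : DecidableEquality X) {P : Pred X 0ℓ} (P? : Decidable P) (κ : X → ℕ) K →
    (∀ x → κ x < K) → ∀ {xs} → Unique xs →
    ∑[ x ∈ xs ] 𝟙 (P? x) ≤
    ∑[ x ∈ xs ] ∑[ y ∈ xs ] 𝟙 (P? x ×-dec P? y ×-dec ¬? (x ≟ y) ×-dec (κ x ≟ℕ κ y)) + K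
  count≤collisions+values {X} _≟_ {P} P? κ K κ<K {xs} u = begin
    ∑[ x ∈ xs ] 𝟙 (P? x)
      ≤⟨ ∑-mono xs (λ x → ≤-trans
           (𝟙-mono (P? x) (P? x ×-dec (κ x ≟ℕ κ x)) (_, refl))
           (∈⇒≤∑ (λ c → 𝟙 (P? x ×-dec (κ x ≟ℕ c))) (∈-upTo⁺ (κ<K x)))) ⟩
    ∑[ x ∈ xs ] ∑[ c ∈ upTo K ] 𝟙 (P? x ×-dec (κ x ≟ℕ c))
      ≡⟨ ∑-swap xs (upTo K) _ ⟩
    ∑[ c ∈ upTo K ] ∑[ x ∈ xs ] 𝟙 (P? x ×-dec (κ x ≟ℕ c))
      ≤⟨ ∑-mono (upTo K) (λ c → count≤1+offDiagonal _≟_ (fibre? c) u) ⟩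
    ∑[ c ∈ upTo K ] (1 + ∑[ x ∈ xs ] ∑[ y ∈ xs ] off c x y)
      ≡⟨ ∑-+ (upTo K) _ _ ⟩
    ∑[ c ∈ upTo K ] 1 + ∑[ c ∈ upTo K ] ∑[ x ∈ xs ] ∑[ y ∈ xs ] off c x y
      ≡⟨ cong₂ _+_ (trans (∑-const (upTo K) 1) (trans (*-identityʳ _) (length-upTo K)))
           (trans (∑-swap (upTo K) xs _) (∑-cong xs (λ x → ∑-swap (upTo K) xs _))) ⟩
    K + ∑[ x ∈ xs ] ∑[ y ∈ xs ] ∑[ c ∈ upTo K ] off c x y
      ≤⟨ +-monoʳ-≤ K (∑-mono xs (λ x → ∑-mono xs (λ y →
           ∑-𝟙≤𝟙 (λ c → fibre? c x ×-dec fibre? c y ×-dec ¬? (x ≟ y)) (collision? x y)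
             (λ { c ((px , κx≡c) , (py , κy≡c) , x≢y) → px , py , x≢y , trans κx≡c (sym κy≡c) })
             (AllPairs.map (λ { c≢c′ ((_ , p) , _) ((_ , q) , _) → c≢c′ (trans (sym p) q) })
               (Unique.upTo⁺ K))))) ⟩
    K + ∑[ x ∈ xs ] ∑[ y ∈ xs ] 𝟙 (collision? x y)
      ≡⟨ +-comm K _ ⟩
    ∑[ x ∈ xs ] ∑[ y ∈ xs ] 𝟙 (collision? x y) + K ∎
    where
    open ≤-Reasoning
    fibre? : ∀ c → Decidable (λ x → P x × κ x ≡ c)
    fibre? c x = P? x ×-dec (κ x ≟ℕ c)
    off : ℕ → X → X → ℕ
    off c = offDiagonal _≟_ (fibre? c)
    collision? : ∀ x y → Dec (P x × P y × ¬ (x ≡ y) × κ x ≡ κ y)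
    collision? x y = P? x ×-dec P? y ×-dec ¬? (x ≟ y) ×-dec (κ x ≟ℕ κ y)

  length-cartesianProduct : ∀ {X Y : Set} (xs : List X) (ys : List Y) →
                            length (cartesianProduct xs ys) ≡ length xs * length ys
  length-cartesianProduct []       ys = refl
  length-cartesianProduct (x ∷ xs) ys = trans (length-++ (map (x ,_) ys))
    (cong₂ _+_ (length-map (x ,_) ys) (length-cartesianProduct xs ys))

  -- Inequalities of means, Cauchy-Schwarz and Hölder without roots

  cube-cancel-≤ : ∀ {m n} → m * m * m ≤ n * n * n → m ≤ n
  cube-cancel-≤ {m} {n} h = ≮⇒≥ λ n<m →
    <⇒≱ (*-mono-< (*-mono-< n<m n<m) n<m) h

  square-cancel-≤ : ∀ {m n} → m * m ≤ n * n → m ≤ n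
  square-cancel-≤ h = ≮⇒≥ λ n<m → <⇒≱ (*-mono-< n<m n<m) h

  -- The hypothesis places `m` below the geometric mean, which need not be an integer; the
  -- comparison is therefore made between squares.
  2-amgm : ∀ m x y → m * m ≤ x * y → 2 * m ≤ x + y
  2-amgm m x y h = square-cancel-≤ (begin
    2 * m * (2 * m)   ≡⟨ e m ⟩
    4 * (m * m)       ≤⟨ *-monoʳ-≤ 4 h ⟩
    4 * (x * y)       ≤⟨ wlog x y ⟩
    (x + y) * (x + y) ∎)
    where
    open ≤-Reasoning
    e : ∀ m → 2 * m * (2 * m) ≡ 4 * (m * m)
    e = solve-∀
    identity : ∀ x d → (x + (x + d)) * (x + (x + d)) ≡ 4 * (x * (x + d)) + d * d
    identity = solve-∀
    ordered : ∀ {x y} → x ≤ y → 4 * (x * y) ≤ (x + y) * (x + y)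
    ordered {x} x≤y with m≤n⇒∃[o]m+o≡n x≤y
    ... | d , refl = subst (4 * (x * (x + d)) ≤_) (sym (identity x d)) (m≤m+n _ _)
    wlog : ∀ x y → 4 * (x * y) ≤ (x + y) * (x + y)
    wlog x y with ≤-total x y
    ... | inj₁ x≤y = ordered x≤y
    ... | inj₂ y≤x = subst₂ (λ p s → 4 * p ≤ s * s) (*-comm y x) (+-comm y x) (ordered y≤x)

  -- Once the variables are sorted as `x`, `x + p`, `x + p + q`, the difference of the cubed sides
  -- is a polynomial with nonnegative coefficients, given by `identity`.
  3-amgm : ∀ m x y z → m * m * m ≤ x * y * z → 3 * m ≤ x + y + z
  3-amgm m x y z h = cube-cancel-≤ (begin
    3 * m * (3 * m) * (3 * m)               ≡⟨ e m ⟩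
    27 * (m * m * m)                        ≤⟨ *-monoʳ-≤ 27 h ⟩
    27 * (x * y * z)                        ≤⟨ sort₃ x y z ⟩
    (x + y + z) * (x + y + z) * (x + y + z) ∎)
    where
    open ≤-Reasoning
    Q : ℕ → ℕ → ℕ → Set
    Q x y z = 27 * (x * y * z) ≤ (x + y + z) * (x + y + z) * (x + y + z)
    e : ∀ m → 3 * m * (3 * m) * (3 * m) ≡ 27 * (m * m * m)
    e = solve-∀
    identity : ∀ x p q →
      (x + (x + p) + (x + p + q)) * (x + (x + p) + (x + p + q)) * (x + (x + p) + (x + p + q)) ≡
      27 * (x * (x + p) * (x + p + q)) +
      (9 * x * (p * p + p * q + q * q) + (p + p + q) * (p + p + q) * (p + p + q))
    identity = solve-∀
    ordered : ∀ {x y z} → x ≤ y → y ≤ z → Q x y z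
    ordered {x} x≤y y≤z with m≤n⇒∃[o]m+o≡n x≤y
    ... | p , refl with m≤n⇒∃[o]m+o≡n y≤z
    ... | q , refl = subst (27 * (x * (x + p) * (x + p + q)) ≤_) (sym (identity x p q)) (m≤m+n _ _)
    perm : ∀ {x y z x′ y′ z′} → x * y * z ≡ x′ * y′ * z′ → x + y + z ≡ x′ + y′ + z′ →
           Q x y z → Q x′ y′ z′
    perm = subst₂ (λ p s → 27 * p ≤ s * s * s)
    swap₁₂ : ∀ {x y z} → Q y x z → Q x y z
    swap₁₂ {x} {y} {z} = perm {y} {x} {z} {x} {y} {z} (cong (_* z) (*-comm y x)) (cong (_+ z) (+-comm y x))
    swap₂₃ : ∀ {x y z} → Q x z y → Q x y z
    swap₂₃ {x} {y} {z} = perm {x} {z} {y} {x} {y} {z} (e₁ x z y) (e₂ x z y)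
      where
      e₁ : ∀ x z y → x * z * y ≡ x * y * z
      e₁ = solve-∀
      e₂ : ∀ x z y → x + z + y ≡ x + y + z
      e₂ = solve-∀
    insert : ∀ {x y z} → x ≤ y → Q x y z
    insert {x} {y} {z} x≤y with ≤-total y z | ≤-total x z
    ... | inj₁ y≤z | _        = ordered x≤y y≤z
    ... | inj₂ z≤y | inj₁ x≤z = swap₂₃ {x} {y} {z} (ordered x≤z z≤y)
    ... | inj₂ z≤y | inj₂ z≤x =
      swap₂₃ {x} {y} {z} (swap₁₂ {x} {z} {y} (ordered z≤x x≤y))
    sort₃ : ∀ x y z → Q x y z
    sort₃ x y z with ≤-total x y
    ... | inj₁ x≤y = insert x≤y
    ... | inj₂ y≤x = swap₁₂ {x} {y} {z} (insert {y} {x} {z} y≤x)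

  -- Expanding the square leaves the cross term 2mS. Since (mS)² ≤ pq · AB = pB · Aq, `2-amgm`
  -- bounds it by pB + Aq.
  cauchySchwarz : ∀ (xs : List X) {f a b : X → ℕ} → (∀ x → f x * f x ≤ a x * b x) →
                  ∑ xs f * ∑ xs f ≤ ∑ xs a * ∑ xs b
  cauchySchwarz [] h = z≤n
  cauchySchwarz (x ∷ xs) {f} {a} {b} h = begin
    (m + S) * (m + S)                     ≡⟨ e₁ m S ⟩
    m * m + 2 * (m * S) + S * S           ≤⟨ +-mono-≤ (+-mono-≤ (h x) cross) ih ⟩
    p * q + (p * B + A * q) + A * B       ≡⟨ e₂ p q A B ⟩
    (p + A) * (q + B)                     ∎
    where
    open ≤-Reasoning
    m = f x
    p = a x
    q = b x
    S = ∑ xs f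
    A = ∑ xs a
    B = ∑ xs b
    ih : S * S ≤ A * B
    ih = cauchySchwarz xs h
    e₁ : ∀ m S → (m + S) * (m + S) ≡ m * m + 2 * (m * S) + S * S
    e₁ = solve-∀
    e₂ : ∀ p q A B → p * q + (p * B + A * q) + A * B ≡ (p + A) * (q + B)
    e₂ = solve-∀
    e₃ : ∀ m S → m * S * (m * S) ≡ m * m * (S * S)
    e₃ = solve-∀
    e₄ : ∀ p q A B → p * q * (A * B) ≡ p * B * (A * q)
    e₄ = solve-∀
    cross : 2 * (m * S) ≤ p * B + A * q
    cross = 2-amgm (m * S) (p * B) (A * q) (begin
      m * S * (m * S)   ≡⟨ e₃ m S ⟩
      m * m * (S * S)   ≤⟨ *-mono-≤ (h x) ih ⟩
      p * q * (A * B)   ≡⟨ e₄ p q A B ⟩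
      p * B * (A * q)   ∎)

  -- In the expanded cube the mixed terms 3m²S and 3mS² are bounded by `3-amgm` against the three
  -- products of the same degree, whose own products are (pqr)²ABC and pqr(ABC)².
  hölder : ∀ (xs : List X) {f a b c : X → ℕ} → (∀ x → f x * f x * f x ≤ a x * b x * c x) →
           ∑ xs f * ∑ xs f * ∑ xs f ≤ ∑ xs a * ∑ xs b * ∑ xs c
  hölder [] h = z≤n
  hölder (x ∷ xs) {f} {a} {b} {c} h = begin
    (m + S) * (m + S) * (m + S)
      ≡⟨ e₁ m S ⟩
    m * m * m + 3 * (m * m * S) + 3 * (m * S * S) + S * S * S
      ≤⟨ +-mono-≤ (+-mono-≤ (+-mono-≤ (h x) cross₁) cross₂) ih ⟩
    p * q * r + (p * q * C + p * B * r + A * q * r) + (p * B * C + A * q * C + A * B * r) + A * B * C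
      ≡⟨ e₂ p q r A B C ⟩
    (p + A) * (q + B) * (r + C) ∎
    where
    open ≤-Reasoning
    m = f x
    p = a x
    q = b x
    r = c x
    S = ∑ xs f
    A = ∑ xs a
    B = ∑ xs b
    C = ∑ xs c
    ih : S * S * S ≤ A * B * C
    ih = hölder xs h
    e₁ : ∀ m S → (m + S) * (m + S) * (m + S) ≡
         m * m * m + 3 * (m * m * S) + 3 * (m * S * S) + S * S * S
    e₁ = solve-∀
    e₂ : ∀ p q r A B C →
      p * q * r + (p * q * C + p * B * r + A * q * r) + (p * B * C + A * q * C + A * B * r) + A * B * C
      ≡ (p + A) * (q + B) * (r + C)
    e₂ = solve-∀
    e₃ : ∀ m S → m * m * S * (m * m * S) * (m * m * S) ≡ m * m * m * (m * m * m) * (S * S * S)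
    e₃ = solve-∀
    e₄ : ∀ p q r A B C → p * q * r * (p * q * r) * (A * B * C) ≡ p * q * C * (p * B * r) * (A * q * r)
    e₄ = solve-∀
    e₅ : ∀ m S → m * S * S * (m * S * S) * (m * S * S) ≡ m * m * m * (S * S * S) * (S * S * S)
    e₅ = solve-∀
    e₆ : ∀ p q r A B C → p * q * r * (A * B * C) * (A * B * C) ≡ p * B * C * (A * q * C) * (A * B * r)
    e₆ = solve-∀
    cross₁ : 3 * (m * m * S) ≤ p * q * C + p * B * r + A * q * r
    cross₁ = 3-amgm (m * m * S) (p * q * C) (p * B * r) (A * q * r)
      (subst₂ _≤_ (sym (e₃ m S)) (e₄ p q r A B C) (*-mono-≤ (*-mono-≤ (h x) (h x)) ih))
    cross₂ : 3 * (m * S * S) ≤ p * B * C + A * q * C + A * B * r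
    cross₂ = 3-amgm (m * S * S) (p * B * C) (A * q * C) (A * B * r)
      (subst₂ _≤_ (sym (e₅ m S)) (e₆ p q r A B C) (*-mono-≤ (*-mono-≤ (h x) ih) ih))

-- Rich lines in a grid

module GridLines where
  open FiniteSums
  open import Data.Nat.Base using (ℕ; zero; suc; _+_; _*_; _∸_; _^_; _≤_; _<_; z≤n; s≤s; NonZero)
  open import Data.Nat.Properties renaming (_≟_ to _≟ℕ_)
  open import Data.Nat.DivMod
    using (_/_; _%_; /-monoˡ-≤; m≡m%n+[m/n]*n; m%n<n; m/n*n≤m; n/1≡n; m<n⇒m/n≡0)
  open import Data.Nat.Logarithm using (⌊log₂_⌋; ⌊log₂⌋-mono-≤; ⌊log₂[2^n]⌋≡n)
  open import Data.Nat.Tactic.RingSolver using (solve-∀)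
  open import Data.Fin.Base as Fin using (Fin; toℕ)
  import Data.Fin.Properties as Fin
  open import Data.List.Base using (List; length; cartesianProduct; allFin; upTo)
  open import Data.List.Properties using (length-tabulate; length-upTo)
  open import Data.List.Membership.Propositional using (_∈_)
  open import Data.List.Membership.Propositional.Properties
    using (∈-allFin; ∈-upTo⁺; ∈-cartesianProduct⁺)
  open import Data.List.Relation.Unary.AllPairs as AllPairs using (AllPairs)
  open import Data.List.Relation.Unary.Unique.Propositional using (Unique)
  import Data.List.Relation.Unary.Unique.Propositional.Properties as Unique
  open import Data.Product.Base using (_×_; _,_; proj₁; proj₂; ∃-syntax)
  open import Data.Product.Properties using (≡-dec)
  open import Data.Sum.Base using (_⊎_; inj₁; inj₂)
  open import Relation.Binary.Definitions using (DecidableEquality; tri<; tri≈; tri>)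
  open import Relation.Binary.PropositionalEquality
    using (_≡_; _≢_; refl; sym; trans; cong; cong₂; subst)
  open import Relation.Nullary.Decidable using (Dec; yes; no; _×-dec_; ¬?)
  open import Relation.Nullary.Negation using (¬_; contradiction)
  open import Level using (0ℓ)
  open import Relation.Unary using (Pred)

  Pt : ℕ → Set
  Pt n = Fin n × Fin n

  _≟ₚ_ : ∀ {n} → DecidableEquality (Pt n)
  _≟ₚ_ = ≡-dec Fin._≟_ Fin._≟_

  pts : ∀ n → List (Pt n)
  pts n = cartesianProduct (allFin n) (allFin n)

  pts-unique : ∀ n → Unique (pts n)
  pts-unique n = Unique.cartesianProduct⁺ (Unique.allFin⁺ n) (Unique.allFin⁺ n)

  ∈-pts : ∀ {n} (p : Pt n) → p ∈ pts n
  ∈-pts (x , y) = ∈-cartesianProduct⁺ (∈-allFin x) (∈-allFin y)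

  length-pts : ∀ n → length (pts n) ≡ n * n
  length-pts n = trans (length-cartesianProduct (allFin n) (allFin n))
    (cong₂ _*_ (length-tabulate {n = n} _) (length-tabulate {n = n} _))

  -- Monotonicity is weak, so that axis-parallel lines have both properties.
  Increasing Decreasing : ∀ {n} → Pred (Pt n) 0ℓ → Set
  Increasing S = ∀ {p q} → S p → S q → proj₁ p Fin.< proj₁ q → ¬ proj₂ q Fin.< proj₂ p
  Decreasing S = ∀ {p q} → S p → S q → proj₁ p Fin.< proj₁ q → ¬ proj₂ p Fin.< proj₂ q

  module _ {n : ℕ} (m : ℕ) .{{_ : NonZero m}} where

    block : Fin n → ℕ
    block x = toℕ x / m

    SameCell : Pt n → Pt n → Set
    SameCell (x , y) (x′ , y′) = block x ≡ block x′ × block y ≡ block y′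

    sameCell? : ∀ p q → Dec (SameCell p q)
    sameCell? (x , y) (x′ , y′) = (block x ≟ℕ block x′) ×-dec (block y ≟ℕ block y′)

    block≤ : ∀ x → block x ≤ n / m
    block≤ x = /-monoˡ-≤ m (<⇒≤ (Fin.toℕ<n x))

    block-cancel-< : ∀ {x y} → block x < block y → x Fin.< y
    block-cancel-< {x} {y} h = ≰⇒> λ y≤x → <⇒≱ h (/-monoˡ-≤ m y≤x)

    -- An index is determined by its quotient and its remainder modulo `m`, and there are `m`
    -- remainders.
    block-size : ∀ c → ∑[ x ∈ allFin n ] 𝟙 (c ≟ℕ block x) ≤ m
    block-size c = begin
      ∑[ x ∈ allFin n ] 𝟙 (c ≟ℕ block x)
        ≤⟨ ∑-mono (allFin n) (λ x → ≤-trans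
             (𝟙-mono (c ≟ℕ block x) (P? (toℕ x % m) x) (_, refl))
             (∈⇒≤∑ (λ e → 𝟙 (P? e x)) (∈-upTo⁺ (m%n<n (toℕ x) m)))) ⟩
      ∑[ x ∈ allFin n ] ∑[ e ∈ upTo m ] 𝟙 (P? e x)
        ≡⟨ ∑-swap (allFin n) (upTo m) _ ⟩
      ∑[ e ∈ upTo m ] ∑[ x ∈ allFin n ] 𝟙 (P? e x)
        ≤⟨ ∑-mono (upTo m) (λ e → ∑-𝟙≤1 (P? e)
             (AllPairs.map (λ x≢y px py → x≢y (P-unique px py)) (Unique.allFin⁺ n))) ⟩
      ∑[ e ∈ upTo m ] 1
        ≡⟨ trans (∑-const (upTo m) 1) (trans (*-identityʳ _) (length-upTo m)) ⟩
      m ∎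
      where
      open ≤-Reasoning
      P? : ∀ e (x : Fin n) → Dec (c ≡ block x × toℕ x % m ≡ e)
      P? e x = (c ≟ℕ block x) ×-dec (toℕ x % m ≟ℕ e)
      P-unique : ∀ {e} {x y : Fin n} → c ≡ block x × toℕ x % m ≡ e → c ≡ block y × toℕ y % m ≡ e → x ≡ y
      P-unique {e} {x} {y} (refl , refl) (q , r) = Fin.toℕ-injective (trans (m≡m%n+[m/n]*n (toℕ x) m)
        (trans (cong₂ (λ r q → r + q * m) (sym r) q) (sym (m≡m%n+[m/n]*n (toℕ y) m))))

    cell-size : ∀ p → ∑[ q ∈ pts n ] 𝟙 (sameCell? p q) ≤ m * m
    cell-size (x , y) = begin
      ∑[ q ∈ pts n ] 𝟙 (sameCell? (x , y) q)
        ≡⟨ ∑-cartesianProduct (allFin n) (allFin n) _ ⟩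
      ∑[ x′ ∈ allFin n ] ∑[ y′ ∈ allFin n ] 𝟙 (sameCell? (x , y) (x′ , y′))
        ≡⟨ ∑-cong (allFin n) (λ x′ → ∑-cong (allFin n) (λ y′ → 𝟙-× (block x ≟ℕ block x′) (block y ≟ℕ block y′))) ⟩
      ∑[ x′ ∈ allFin n ] ∑[ y′ ∈ allFin n ] (𝟙 (block x ≟ℕ block x′) * 𝟙 (block y ≟ℕ block y′))
        ≡⟨ ∑-product (allFin n) (allFin n) (λ x′ → 𝟙 (block x ≟ℕ block x′)) (λ y′ → 𝟙 (block y ≟ℕ block y′)) ⟩
      ∑[ x′ ∈ allFin n ] 𝟙 (block x ≟ℕ block x′) * ∑[ y′ ∈ allFin n ] 𝟙 (block y ≟ℕ block y′)
        ≤⟨ *-mono-≤ (block-size (block x)) (block-size (block y)) ⟩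
      m * m ∎
      where open ≤-Reasoning

    -- A monotone set meets at most 2β + 1 cells, where β is the largest block:
    -- along it, the sum (or the difference) of the two blocks is monotone.
    cellKey : ∀ {S : Pred (Pt n) 0ℓ} → Increasing S ⊎ Decreasing S →
      ∃[ κ ] ((∀ p → κ p < 2 * (n / m) + 1) × (∀ {p q} → S p → S q → κ p ≡ κ q → SameCell p q))
    cellKey {S} (inj₁ inc) = κ , κ< , collide
      where
      κ : Pt n → ℕ
      κ (x , y) = block x + block y
      κ< : ∀ p → κ p < 2 * (n / m) + 1
      κ< (x , y) = subst (κ (x , y) <_) (e (n / m)) (s≤s (+-mono-≤ (block≤ x) (block≤ y)))
        where
        e : ∀ β → suc (β + β) ≡ 2 * β + 1
        e = solve-∀
      -- If the first block grew, equal sums would force the second to shrink, and then the indices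
      -- themselves would violate `inc`.
      not< : ∀ {p q} → S p → S q → κ p ≡ κ q → ¬ block (proj₁ p) < block (proj₁ q)
      not< sp sq e h = inc sp sq (block-cancel-< h)
        (block-cancel-< (≰⇒> λ h′ → <⇒≢ (+-mono-<-≤ h h′) e))
      collide : ∀ {p q} → S p → S q → κ p ≡ κ q → SameCell p q
      collide {p} {q} sp sq e with <-cmp (block (proj₁ p)) (block (proj₁ q))
      ... | tri< h _ _  = contradiction h (not< sp sq e)
      ... | tri> _ _ h  = contradiction h (not< sq sp (sym e))
      ... | tri≈ _ h _  = h , +-cancelˡ-≡ (block (proj₁ p)) _ _
                                (trans e (cong (_+ block (proj₂ q)) (sym h)))
    cellKey {S} (inj₂ dec) = κ , κ< , collide
      where
      β = n / m
      κ : Pt n → ℕ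
      -- Subtraction from `β` reverses the second axis; it never truncates because of `block≤`.
      κ (x , y) = block x + (β ∸ block y)
      κ< : ∀ p → κ p < 2 * β + 1
      κ< (x , y) = subst (κ (x , y) <_) (e β) (s≤s (+-mono-≤ (block≤ x) (m∸n≤m β (block y))))
        where
        e : ∀ β → suc (β + β) ≡ 2 * β + 1
        e = solve-∀
      not< : ∀ {p q} → S p → S q → κ p ≡ κ q → ¬ block (proj₁ p) < block (proj₁ q)
      not< sp sq e h = dec sp sq (block-cancel-< h)
        (block-cancel-< (≰⇒> λ h′ → <⇒≢ (+-mono-<-≤ h (∸-monoʳ-≤ β h′)) e))
      collide : ∀ {p q} → S p → S q → κ p ≡ κ q → SameCell p q
      collide {p} {q} sp sq e with <-cmp (block (proj₁ p)) (block (proj₁ q))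
      ... | tri< h _ _  = contradiction h (not< sp sq e)
      ... | tri> _ _ h  = contradiction h (not< sq sp (sym e))
      ... | tri≈ _ h _  = h , ∸-cancelˡ-≡ (block≤ (proj₂ p)) (block≤ (proj₂ q))
        (+-cancelˡ-≡ (block (proj₁ p)) _ _ (trans e (cong (_+ (β ∸ block (proj₂ q))) (sym h))))

  -- What the counting knows of the plane: `Fin n` carries the order of the coordinates, and a line
  -- is a decidable monotone relation on index pairs.
  record Incidence (Λ : Set) (n : ℕ) : Set₁ where
    field
      On       : Λ → Pt n → Set
      on?      : ∀ ℓ p → Dec (On ℓ p)
      monotone : ∀ ℓ → Increasing (On ℓ) ⊎ Decreasing (On ℓ)

  module RichLines {n : ℕ} {Λ : Set} (incidence : Incidence Λ n) where
    open Incidence incidence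

    #on : Λ → ℕ
    #on ℓ = ∑[ p ∈ pts n ] 𝟙 (on? ℓ p)

    cubeIfRich : Λ → ℕ
    cubeIfRich ℓ = 𝟙 (2 ≤? #on ℓ) * (#on ℓ * #on ℓ * #on ℓ)

    module _ (m : ℕ) .{{_ : NonZero m}} where

      Close : Λ → Pt n → Pt n → Set
      Close ℓ p q = On ℓ p × On ℓ q × ¬ (p ≡ q) × SameCell m p q

      close? : ∀ ℓ p q → Dec (Close ℓ p q)
      close? ℓ p q = on? ℓ p ×-dec on? ℓ q ×-dec ¬? (p ≟ₚ q) ×-dec sameCell? m p q

      #close : Λ → ℕ
      #close ℓ = ∑[ p ∈ pts n ] ∑[ q ∈ pts n ] 𝟙 (close? ℓ p q)

      -- The pigeonhole bound with the keys of `cellKey`: points of the line with the same key share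
      -- a cell.
      #on≤#close+ : ∀ ℓ → #on ℓ ≤ #close ℓ + (2 * (n / m) + 1)
      #on≤#close+ ℓ with cellKey m (monotone ℓ)
      ... | κ , κ< , collide = ≤-trans
        (count≤collisions+values _≟ₚ_ (on? ℓ) κ (2 * (n / m) + 1) κ< (pts-unique n))
        (+-monoˡ-≤ _ (∑-mono (pts n) (λ p → ∑-mono (pts n) (λ q → 𝟙-mono
          (on? ℓ p ×-dec on? ℓ q ×-dec ¬? (p ≟ₚ q) ×-dec (κ p ≟ℕ κ q)) (close? ℓ p q)
          (λ { (sp , sq , p≢q , e) → sp , sq , p≢q , collide sp sq e })))))

    -- Cells of side 1 are single points. With `#on≤#close+` this bounds `#on ℓ` by 2n + 1.
    #close-1 : ∀ ℓ → #close 1 ℓ ≡ 0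
    #close-1 ℓ = trans (∑-cong (pts n) λ p → trans (∑-cong (pts n) λ q →
        𝟙-no (close? 1 ℓ p q) λ { (_ , _ , p≢q , e₁ , e₂) → p≢q (cong₂ _,_ (f e₁) (f e₂)) })
        (∑-zero (pts n))) (∑-zero (pts n))
      where
      f : ∀ {x y : Fin n} → block 1 x ≡ block 1 y → x ≡ y
      f {x} {y} e = Fin.toℕ-injective (trans (sym (n/1≡n (toℕ x))) (trans e (n/1≡n (toℕ y))))

    Separated : Λ → Λ → Set
    Separated ℓ ℓ′ = ∀ {p q} → p ≢ q → On ℓ p → On ℓ q → On ℓ′ p → ¬ On ℓ′ q

    module _ {lines : List Λ} (separated : AllPairs Separated lines) where

      ∑-#close≤ : ∀ m .{{_ : NonZero m}} → ∑ lines (#close m) ≤ n * n * (m * m)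
      ∑-#close≤ m = begin
        ∑[ ℓ ∈ lines ] ∑[ p ∈ pts n ] ∑[ q ∈ pts n ] 𝟙 (close? m ℓ p q)
          ≡⟨ trans (∑-swap lines (pts n) _) (∑-cong (pts n) λ p → ∑-swap lines (pts n) _) ⟩
        ∑[ p ∈ pts n ] ∑[ q ∈ pts n ] ∑[ ℓ ∈ lines ] 𝟙 (close? m ℓ p q)
          ≤⟨ ∑-mono (pts n) (λ p → ∑-mono (pts n) (λ q →
               ∑-𝟙≤𝟙 (λ ℓ → close? m ℓ p q) (sameCell? m p q) (λ { _ (_ , _ , _ , c) → c })
                 (AllPairs.map (λ { sep (a , b , p≢q , _) (c , d , _) → sep p≢q a b c d }) separated))) ⟩
        ∑[ p ∈ pts n ] ∑[ q ∈ pts n ] 𝟙 (sameCell? m p q)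
          ≤⟨ ∑-mono (pts n) (cell-size m) ⟩
        ∑[ p ∈ pts n ] (m * m)
          ≡⟨ trans (∑-const (pts n) (m * m)) (cong (_* (m * m)) (length-pts n)) ⟩
        n * n * (m * m) ∎
        where open ≤-Reasoning

      private
        n² = n * n

      -- At the scale m ≈ n / #on ℓ a line meets few cells compared to #on ℓ,
      -- hence it has at least #on ℓ / 2 pairs of points in a common cell.
      Scale : ℕ → Λ → Set
      Scale j ℓ = 4 * ((n / 2 ^ j) {{m^n≢0 2 j}}) + 2 ≤ #on ℓ × #on ℓ * 2 ^ j ≤ 16 * n

      scale? : ∀ j ℓ → Dec (Scale j ℓ)
      scale? j ℓ = (_ ≤? _) ×-dec (_ ≤? _)

      weight : ℕ → Λ → ℕ
      weight j ℓ = 𝟙 (scale? j ℓ) * (#on ℓ * #on ℓ * #on ℓ)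

      -- The lower bound in `Scale` is twice the number of cells, so at least half of the points are
      -- paid for by close pairs: i ≤ 2q. The upper bound gives (im)² ≤ 256n², and 512 = 256 · 2.
      weight≤ : ∀ j ℓ → weight j ℓ * (2 ^ j * 2 ^ j) ≤ 512 * n² * #close (2 ^ j) {{m^n≢0 2 j}} ℓ
      weight≤ j ℓ with scale? j ℓ
      ... | no _ = z≤n
      ... | yes (big , small) = begin
        1 * (i * i * i) * (m * m)       ≡⟨ e₁ i m ⟩
        (i * m) * (i * m) * i           ≤⟨ *-mono-≤ (*-mono-≤ small small) i≤2q ⟩
        16 * n * (16 * n) * (2 * q)     ≡⟨ e₂ n q ⟩
        512 * n² * q                    ∎
        where
        open ≤-Reasoning
        instance _ = m^n≢0 2 j
        i = #on ℓ
        m = 2 ^ j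
        q = #close m ℓ
        β = n / m
        e₁ : ∀ i m → 1 * (i * i * i) * (m * m) ≡ (i * m) * (i * m) * i
        e₁ = solve-∀
        e₂ : ∀ n q → 16 * n * (16 * n) * (2 * q) ≡ 512 * (n * n) * q
        e₂ = solve-∀
        e₃ : ∀ q β → 2 * (q + (2 * β + 1)) ≡ 2 * q + (4 * β + 2)
        e₃ = solve-∀
        e₄ : ∀ i → i + i ≡ 2 * i
        e₄ = solve-∀
        i≤2q : i ≤ 2 * q
        i≤2q = +-cancelʳ-≤ i i (2 * q) (begin
          i + i                     ≡⟨ e₄ i ⟩
          2 * i                     ≤⟨ *-monoʳ-≤ 2 (#on≤#close+ m ℓ) ⟩
          2 * (q + (2 * β + 1))     ≡⟨ e₃ q β ⟩
          2 * q + (4 * β + 2)       ≤⟨ +-monoʳ-≤ (2 * q) big ⟩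
          2 * q + i                 ∎)

      -- The `m * m` gained in `weight≤` cancels the one lost in counting close pairs. Every scale
      -- thus has the same bound, and the logarithm is the number of scales.
      ∑-weight≤ : ∀ j → ∑ lines (weight j) ≤ 512 * (n² * n²)
      ∑-weight≤ j = *-cancelʳ-≤ _ _ (m * m) {{m*n≢0 m m}} (begin
        ∑ lines (weight j) * (m * m)              ≡⟨ ∑-*ʳ lines (weight j) (m * m) ⟨
        ∑[ ℓ ∈ lines ] (weight j ℓ * (m * m))     ≤⟨ ∑-mono lines (weight≤ j) ⟩
        ∑[ ℓ ∈ lines ] (512 * n² * #close m ℓ)    ≡⟨ ∑-*ˡ lines (512 * n²) (#close m) ⟩
        512 * n² * ∑ lines (#close m)             ≤⟨ *-monoʳ-≤ (512 * n²) (∑-#close≤ m) ⟩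
        512 * n² * (n² * (m * m))                 ≡⟨ e n² (m * m) ⟩
        512 * (n² * n²) * (m * m)                 ∎)
        where
        open ≤-Reasoning
        instance _ = m^n≢0 2 j
        m = 2 ^ j
        e : ∀ a b → 512 * a * (a * b) ≡ 512 * (a * a) * b
        e = solve-∀

      -- Halve the cells until the upper bound of `Scale` holds. If it fails at `suc j`, the line
      -- has more than 8 (n / 2^j) points, so the lower bound persists at `j`.
      findScale : ∀ ℓ → 2 ≤ #on ℓ → ∀ j → 4 * ((n / 2 ^ j) {{m^n≢0 2 j}}) + 2 ≤ #on ℓ →
                  ∃[ k ] (k ≤ j × Scale k ℓ)
      findScale ℓ 2≤i j big with #on ℓ * 2 ^ j ≤? 16 * n
      ... | yes small = j , ≤-refl , big , small
      -- With cells of side 1 the lower bound is impossible, as 4n + 2 ≤ i contradicts i ≤ 2n + 1.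
      findScale ℓ 2≤i zero big | no _ = contradiction (begin-strict
        #on ℓ                         ≤⟨ #on≤#close+ 1 ℓ ⟩
        #close 1 ℓ + (2 * (n / 1) + 1) ≡⟨ cong (_+ _) (#close-1 ℓ) ⟩
        2 * (n / 1) + 1               ≤⟨ +-monoˡ-≤ 1 (*-monoˡ-≤ (n / 1) (s≤s (s≤s (z≤n {2})))) ⟩
        4 * (n / 1) + 1               <⟨ +-monoʳ-< (4 * (n / 1)) (n<1+n 1) ⟩
        4 * (n / 1) + 2               ≤⟨ big ⟩
        #on ℓ                         ∎) (<-irrefl refl)
        where open ≤-Reasoning
      findScale ℓ 2≤i (suc j) big | no ¬small = case-below (findScale ℓ 2≤i j big′)
        where
        open ≤-Reasoning
        instance _ = m^n≢0 2 j
        i = #on ℓ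
        m = 2 ^ j
        β = n / m
        case-below : ∃[ k ] (k ≤ j × Scale k ℓ) → ∃[ k ] (k ≤ suc j × Scale k ℓ)
        case-below (k , k≤j , s) = k , m≤n⇒m≤1+n k≤j , s
        e₁ : ∀ β m → 8 * β * (2 * m) ≡ 16 * (β * m)
        e₁ = solve-∀
        8β<i : 8 * β < i
        8β<i = *-cancelʳ-< (2 * m) (8 * β) i (begin-strict
          8 * β * (2 * m)   ≡⟨ e₁ β m ⟩
          16 * (β * m)      ≤⟨ *-monoʳ-≤ 16 (m/n*n≤m n m) ⟩
          16 * n            <⟨ ≰⇒> ¬small ⟩
          i * (2 * m)       ∎)
        -- For β ≥ 1 one has 8β + 1 ≥ 4β + 2; for β = 0 the bound is the richness `2≤i`.
        combine : ∀ β → 8 * β < i → 4 * β + 2 ≤ i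
        combine zero    _ = 2≤i
        combine (suc b) h = ≤-trans (≤-trans (m≤m+n _ (4 * b + 3)) (≤-reflexive (e₂ b))) h
          where
          e₂ : ∀ b → 4 * suc b + 2 + (4 * b + 3) ≡ suc (8 * suc b)
          e₂ = solve-∀
        big′ : 4 * β + 2 ≤ i
        big′ = combine β 8β<i

      private
        J = suc ⌊log₂ n ⌋
        n<2^J : n < 2 ^ J
        n<2^J = ≰⇒> λ 2^J≤n → <-irrefl refl
          (subst (_≤ ⌊log₂ n ⌋) (⌊log₂[2^n]⌋≡n J) (⌊log₂⌋-mono-≤ 2^J≤n))

      -- The descent starts at `J`, where `n / 2 ^ J` is zero and the lower bound of `Scale` reads 2
      -- ≤ `#on ℓ`.
      cubeIfRich≤ : ∀ ℓ → cubeIfRich ℓ ≤ ∑[ j ∈ upTo (suc J) ] weight j ℓ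
      cubeIfRich≤ ℓ with 2 ≤? #on ℓ
      ... | no _ = z≤n
      ... | yes 2≤i with findScale ℓ 2≤i J
        (subst (λ β → 4 * β + 2 ≤ #on ℓ) (sym (m<n⇒m/n≡0 {{m^n≢0 2 J}} n<2^J)) 2≤i)
      ... | k , k≤J , s = ≤-trans
        (≤-reflexive (cong (_* (#on ℓ * #on ℓ * #on ℓ)) (sym (𝟙-yes (scale? k ℓ) s))))
        (∈⇒≤∑ (λ j → weight j ℓ) (∈-upTo⁺ (s≤s k≤J)))

      ∑-cubeIfRich≤ : ∑ lines cubeIfRich ≤ (2 + ⌊log₂ n ⌋) * (512 * (n * n * (n * n)))
      ∑-cubeIfRich≤ = begin
        ∑ lines cubeIfRich
          ≤⟨ ∑-mono lines cubeIfRich≤ ⟩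
        ∑[ ℓ ∈ lines ] ∑[ j ∈ upTo (suc J) ] weight j ℓ
          ≡⟨ ∑-swap lines (upTo (suc J)) _ ⟩
        ∑[ j ∈ upTo (suc J) ] ∑ lines (weight j)
          ≤⟨ ∑-mono (upTo (suc J)) ∑-weight≤ ⟩
        ∑[ j ∈ upTo (suc J) ] (512 * (n² * n²))
          ≡⟨ trans (∑-const (upTo (suc J)) (512 * (n² * n²))) (cong (_* (512 * (n² * n²))) (length-upTo (suc J))) ⟩
        suc J * (512 * (n² * n²)) ∎
        where open ≤-Reasoning

-- Hölder's inequality over the lines

module LineSums where
  open FiniteSums
  open import Data.Nat.Base using (ℕ; _+_; _*_; _≤_; z≤n; s≤s; s≤s⁻¹)
  open import Data.Nat.Properties
  open import Data.Nat.Tactic.RingSolver using (solve-∀)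
  open import Data.List.Base using (List)
  open import Data.Product.Base using (_×_; _,_; ∃-syntax)
  open import Data.Sum.Base using (inj₁; inj₂)
  open import Relation.Binary.PropositionalEquality
    using (_≡_; refl; sym; trans; cong; cong₂)
  open import Relation.Nullary.Decidable using (Dec; yes; no; _×-dec_; ¬?)
  open import Relation.Nullary.Negation using (¬_)

  cube-mono : ∀ {m n} → m ≤ n → m * m * m ≤ n * n * n
  cube-mono m≤n = *-mono-≤ (*-mono-≤ m≤n m≤n) m≤n

  -- Replace all three numbers by the largest, whose cube is still at most `M`.
  cube-+₃ : ∀ {a b c M} → a * a * a ≤ M → b * b * b ≤ M → c * c * c ≤ M →
            (a + b + c) * (a + b + c) * (a + b + c) ≤ 27 * M
  cube-+₃ {a} {b} {c} {M} a³≤M b³≤M c³≤M with max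
    where
    max : ∃[ m ] (a ≤ m × b ≤ m × c ≤ m × m * m * m ≤ M)
    max with ≤-total a b | ≤-total b c | ≤-total a c
    ... | inj₁ a≤b | inj₁ b≤c | _        = c , ≤-trans a≤b b≤c , b≤c , ≤-refl , c³≤M
    ... | inj₁ a≤b | inj₂ c≤b | _        = b , a≤b , ≤-refl , c≤b , b³≤M
    ... | inj₂ b≤a | _        | inj₁ a≤c = c , a≤c , ≤-trans b≤a a≤c , ≤-refl , c³≤M
    ... | inj₂ b≤a | _        | inj₂ c≤a = a , ≤-refl , b≤a , c≤a , a³≤M
  ... | m , a≤m , b≤m , c≤m , m³≤M = begin
    (a + b + c) * (a + b + c) * (a + b + c) ≤⟨ cube-mono (+-mono-≤ (+-mono-≤ a≤m b≤m) c≤m) ⟩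
    (m + m + m) * (m + m + m) * (m + m + m) ≡⟨ e m ⟩
    27 * (m * m * m)                        ≤⟨ *-monoʳ-≤ 27 m³≤M ⟩
    27 * M                                  ∎
    where
    open ≤-Reasoning
    e : ∀ m → (m + m + m) * (m + m + m) * (m + m + m) ≡ 27 * (m * m * m)
    e = solve-∀

  -- Here i₁, i₂, i₃ are the richnesses of a line in the three grids and p is its
  -- number of pairs of distinct points in the first two.
  module _ {Λ : Set} (lines : List Λ) (i₁ i₂ i₃ p : Λ → ℕ) (p≤i₁i₂ : ∀ ℓ → p ℓ ≤ i₁ ℓ * i₂ ℓ) where

    private
      cubeIf : (Λ → ℕ) → Λ → ℕ
      cubeIf i ℓ = 𝟙 (2 ≤? i ℓ) * (i ℓ * i ℓ * i ℓ)

      poor? : ∀ ℓ → Dec (¬ (2 ≤ i₁ ℓ × 2 ≤ i₂ ℓ))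
      poor? ℓ = ¬? ((2 ≤? i₁ ℓ) ×-dec (2 ≤? i₂ ℓ))

      -- Among the lines rich in the third grid, `f` collects those poor in the first or second and
      -- `g` those rich in all three. The indicators sit inside the factors so that cubing turns
      -- these into `cubeIf`.
      p′ f g : Λ → ℕ
      p′ ℓ = 𝟙 (poor? ℓ) * p ℓ
      f  ℓ = p′ ℓ * (𝟙 (2 ≤? i₃ ℓ) * i₃ ℓ)
      g  ℓ = 𝟙 (2 ≤? i₁ ℓ) * i₁ ℓ * (𝟙 (2 ≤? i₂ ℓ) * i₂ ℓ) * (𝟙 (2 ≤? i₃ ℓ) * i₃ ℓ)

      p·i≤ : ∀ p i r → p * i ≤ p + (1 * p) * (1 * i) + r
      p·i≤ p i r = ≤-trans (m≤n+m (p * i) (p + r)) (≤-reflexive (e p i r))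
        where
        e : ∀ p i r → p + r + p * i ≡ p + (1 * p) * (1 * i) + r
        e = solve-∀

      p·i₃≤ : ∀ ℓ → p ℓ * i₃ ℓ ≤ p ℓ + f ℓ + g ℓ
      p·i₃≤ ℓ with 2 ≤? i₃ ℓ
      ... | no i₃≱2 = begin
        p ℓ * i₃ ℓ  ≤⟨ *-monoʳ-≤ (p ℓ) (s≤s⁻¹ (≰⇒> i₃≱2)) ⟩
        p ℓ * 1     ≡⟨ *-identityʳ (p ℓ) ⟩
        p ℓ         ≤⟨ m≤m+n (p ℓ) _ ⟩
        p ℓ + _     ≡⟨ +-assoc (p ℓ) _ _ ⟨
        p ℓ + _ + _ ∎
        where open ≤-Reasoning
      ... | yes _ with 2 ≤? i₁ ℓ | 2 ≤? i₂ ℓ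
      ... | yes _ | yes _ = begin
        p ℓ * i₃ ℓ                                    ≤⟨ *-monoˡ-≤ (i₃ ℓ) (p≤i₁i₂ ℓ) ⟩
        i₁ ℓ * i₂ ℓ * i₃ ℓ                            ≡⟨ e (i₁ ℓ) (i₂ ℓ) (i₃ ℓ) ⟩
        1 * i₁ ℓ * (1 * i₂ ℓ) * (1 * i₃ ℓ)            ≤⟨ m≤n+m _ (p ℓ + 0) ⟩
        p ℓ + 0 + 1 * i₁ ℓ * (1 * i₂ ℓ) * (1 * i₃ ℓ)  ∎
        where
        open ≤-Reasoning
        e : ∀ a b c → a * b * c ≡ 1 * a * (1 * b) * (1 * c)
        e = solve-∀
      ... | yes _ | no _  = p·i≤ (p ℓ) (i₃ ℓ) _
      ... | no _  | _     = p·i≤ (p ℓ) (i₃ ℓ) _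

      cubeIf≡ : ∀ {P : Set} (P? : Dec P) i → 𝟙 P? * i * (𝟙 P? * i) * (𝟙 P? * i) ≡ 𝟙 P? * (i * i * i)
      cubeIf≡ (no _)  i = refl
      cubeIf≡ (yes _) i = e i
        where
        e : ∀ i → 1 * i * (1 * i) * (1 * i) ≡ 1 * (i * i * i)
        e = solve-∀

      p′≤p : ∀ ℓ → p′ ℓ ≤ p ℓ
      p′≤p ℓ = ≤-trans (*-monoˡ-≤ (p ℓ) (𝟙≤1 (poor? ℓ))) (≤-reflexive (*-identityˡ (p ℓ)))

      -- One factor `p′` is relaxed to `p`, whose sum is known; the other two keep the restriction,
      -- since squares of `p` are controlled on poor lines only.
      f³≤ : ∀ ℓ → f ℓ * f ℓ * f ℓ ≤ cubeIf i₃ ℓ * p ℓ * (p′ ℓ * p′ ℓ)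
      f³≤ ℓ = begin
        f ℓ * f ℓ * f ℓ
          ≡⟨ e (p′ ℓ) (𝟙 (2 ≤? i₃ ℓ) * i₃ ℓ) ⟩
        𝟙 (2 ≤? i₃ ℓ) * i₃ ℓ * (𝟙 (2 ≤? i₃ ℓ) * i₃ ℓ) * (𝟙 (2 ≤? i₃ ℓ) * i₃ ℓ) * p′ ℓ * (p′ ℓ * p′ ℓ)
          ≡⟨ cong (λ c → c * p′ ℓ * (p′ ℓ * p′ ℓ)) (cubeIf≡ (2 ≤? i₃ ℓ) (i₃ ℓ)) ⟩
        cubeIf i₃ ℓ * p′ ℓ * (p′ ℓ * p′ ℓ)
          ≤⟨ *-monoˡ-≤ (p′ ℓ * p′ ℓ) (*-monoʳ-≤ (cubeIf i₃ ℓ) (p′≤p ℓ)) ⟩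
        cubeIf i₃ ℓ * p ℓ * (p′ ℓ * p′ ℓ) ∎
        where
        open ≤-Reasoning
        e : ∀ p i → p * i * (p * i) * (p * i) ≡ i * i * i * p * (p * p)
        e = solve-∀

      g³≤ : ∀ ℓ → g ℓ * g ℓ * g ℓ ≤ cubeIf i₁ ℓ * cubeIf i₂ ℓ * cubeIf i₃ ℓ
      g³≤ ℓ = ≤-reflexive (trans (e (𝟙 (2 ≤? i₁ ℓ) * i₁ ℓ) (𝟙 (2 ≤? i₂ ℓ) * i₂ ℓ) (𝟙 (2 ≤? i₃ ℓ) * i₃ ℓ))
        (cong₂ _*_ (cong₂ _*_ (cubeIf≡ (2 ≤? i₁ ℓ) (i₁ ℓ)) (cubeIf≡ (2 ≤? i₂ ℓ) (i₂ ℓ)))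
          (cubeIf≡ (2 ≤? i₃ ℓ) (i₃ ℓ))))
        where
        e : ∀ a b c → a * b * c * (a * b * c) * (a * b * c) ≡ a * a * a * (b * b * b) * (c * c * c)
        e = solve-∀

      -- A pair count p ≤ j either is at most 1 or at most a richness j ≥ 2.
      p³≤ : ∀ p j → p ≤ j → p * p * p ≤ p + 𝟙 (2 ≤? j) * (j * j * j)
      p³≤ p j p≤j with 2 ≤? j
      ... | yes _  = ≤-trans (cube-mono p≤j)
        (≤-trans (≤-reflexive (sym (*-identityˡ _))) (m≤n+m _ p))
      ... | no j≱2 = begin
        p * p * p ≤⟨ *-monoˡ-≤ p (*-mono-≤ p≤1 p≤1) ⟩
        1 * p     ≡⟨ e p ⟩
        p + 0     ∎
        where
        open ≤-Reasoning
        p≤1 : p ≤ 1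
        p≤1 = ≤-trans p≤j (s≤s⁻¹ (≰⇒> j≱2))
        e : ∀ p → 1 * p ≡ p + 0
        e = solve-∀

      -- On a poor line one of `i₁`, `i₂` is at most 1, so `p` is at most the other, and `p³≤`
      -- applies to it.
      p′⁴≤ : ∀ ℓ → p′ ℓ * p′ ℓ * (p′ ℓ * p′ ℓ) ≤ p ℓ * (p ℓ + cubeIf i₁ ℓ + cubeIf i₂ ℓ)
      p′⁴≤ ℓ with poor? ℓ
      ... | no _ = z≤n
      ... | yes poor = begin
        1 * p ℓ * (1 * p ℓ) * (1 * p ℓ * (1 * p ℓ))       ≡⟨ e (p ℓ) ⟩
        p ℓ * (p ℓ * p ℓ * p ℓ)                           ≤⟨ *-monoʳ-≤ (p ℓ) cube≤ ⟩
        p ℓ * (p ℓ + cubeIf i₁ ℓ + cubeIf i₂ ℓ)           ∎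
        where
        open ≤-Reasoning
        e : ∀ p → 1 * p * (1 * p) * (1 * p * (1 * p)) ≡ p * (p * p * p)
        e = solve-∀
        cube≤ : p ℓ * p ℓ * p ℓ ≤ p ℓ + cubeIf i₁ ℓ + cubeIf i₂ ℓ
        cube≤ with 2 ≤? i₁ ℓ
        ... | no i₁≱2 = ≤-trans
          (p³≤ (p ℓ) (i₂ ℓ) (≤-trans (p≤i₁i₂ ℓ)
            (≤-trans (*-monoˡ-≤ (i₂ ℓ) (s≤s⁻¹ (≰⇒> i₁≱2))) (≤-reflexive (*-identityˡ (i₂ ℓ))))))
          (+-monoˡ-≤ (cubeIf i₂ ℓ) (m≤m+n (p ℓ) 0))
        ... | yes 2≤i₁ = ≤-trans
          (p³≤ (p ℓ) (i₁ ℓ) (≤-trans (p≤i₁i₂ ℓ) (≤-trans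
            (*-monoʳ-≤ (i₁ ℓ) (s≤s⁻¹ (≰⇒> (λ 2≤i₂ → poor (2≤i₁ , 2≤i₂)))))
            (≤-reflexive (*-identityʳ (i₁ ℓ))))))
          (≤-trans (≤-reflexive (cong (λ t → p ℓ + t * (i₁ ℓ * i₁ ℓ * i₁ ℓ)) (𝟙-yes (2 ≤? i₁ ℓ) 2≤i₁))) (m≤m+n _ (cubeIf i₂ ℓ)))

    module _ {a b c lam : ℕ} (a≤b : a ≤ b) (b≤c : b ≤ c) (1≤lam : 1 ≤ lam)
      (∑p≤  : ∑ lines p ≤ a * a * (b * b))
      (∑i₁³≤ : ∑ lines (cubeIf i₁) ≤ lam * (a * a * (a * a)))
      (∑i₂³≤ : ∑ lines (cubeIf i₂) ≤ lam * (b * b * (b * b)))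
      (∑i₃³≤ : ∑ lines (cubeIf i₃) ≤ lam * (c * c * (c * c))) where

      private
        open ≤-Reasoning
        -- The cube of a · b^(5/3) · c^(4/3).
        D = a * a * a * (b * b * b * b * b) * (c * c * c * c)
        M = 27 * (lam * lam * lam) * D
        a≤c = ≤-trans a≤b b≤c

        1≤lam³ : 1 ≤ lam * lam * lam
        1≤lam³ = cube-mono {1} 1≤lam

        A B C Z : ℕ
        A = ∑ lines p
        B = ∑ lines f
        C = ∑ lines g
        Z = ∑[ ℓ ∈ lines ] (p′ ℓ * p′ ℓ)

        -- a⁶b⁶ = a³b⁵ · a³b, and a³b ≤ c⁴.
        A³≤ : A * A * A ≤ M
        A³≤ = begin
          A * A * A                                       ≤⟨ cube-mono ∑p≤ ⟩
          a * a * (b * b) * (a * a * (b * b)) * (a * a * (b * b))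
                                                          ≡⟨ e a b ⟩
          a * a * a * (b * b * b * b * b) * (a * a * a * b)
            ≤⟨ *-monoʳ-≤ (a * a * a * (b * b * b * b * b)) (*-mono-≤ (cube-mono a≤c) b≤c) ⟩
          D                                               ≡⟨ *-identityˡ D ⟨
          1 * D  ≤⟨ *-monoˡ-≤ D {1} {27 * (lam * lam * lam)} (*-mono-≤ (s≤s (z≤n {26})) 1≤lam³) ⟩
          M                                               ∎
          where
          e : ∀ a b → a * a * (b * b) * (a * a * (b * b)) * (a * a * (b * b)) ≡
                      a * a * a * (b * b * b * b * b) * (a * a * a * b)
          e = solve-∀

        Z≤ : Z ≤ 3 * lam * (a * (b * b * b))
        Z≤ = square-cancel-≤ (begin
          Z * Z
            ≤⟨ cauchySchwarz lines p′⁴≤ ⟩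
          A * ∑[ ℓ ∈ lines ] (p ℓ + cubeIf i₁ ℓ + cubeIf i₂ ℓ)
            ≡⟨ cong (A *_) (trans (∑-+ lines _ _) (cong (_+ ∑ lines (cubeIf i₂)) (∑-+ lines _ _))) ⟩
          A * (A + ∑ lines (cubeIf i₁) + ∑ lines (cubeIf i₂))
            ≤⟨ *-mono-≤ ∑p≤ (+-mono-≤ (+-mono-≤ A≤ i₁≤) ∑i₂³≤) ⟩
          a * a * (b * b) * (L + L + L)
            ≡⟨ e₁ a b lam ⟩
          3 * lam * (a * (b * b * b) * (a * (b * b * b)))
            -- The constant and `lam` are enlarged to squares so that the right-hand side becomes a
            -- perfect square.
            ≤⟨ *-monoˡ-≤ (a * (b * b * b) * (a * (b * b * b))) (*-mono-≤ 3≤9 lam≤lam²) ⟩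
          9 * (lam * lam) * (a * (b * b * b) * (a * (b * b * b)))
            ≡⟨ e₂ a b lam ⟩
          3 * lam * (a * (b * b * b)) * (3 * lam * (a * (b * b * b))) ∎)
          where
          L = lam * (b * b * (b * b))
          3≤9 : 3 ≤ 9
          3≤9 = m≤m+n 3 6
          lam≤lam² : lam ≤ lam * lam
          lam≤lam² = ≤-trans (≤-reflexive (sym (*-identityˡ lam))) (*-monoˡ-≤ lam 1≤lam)
          A≤ : A ≤ L
          A≤ = ≤-trans ∑p≤ (≤-trans (*-monoˡ-≤ (b * b) (*-mono-≤ a≤b a≤b))
            (≤-trans (≤-reflexive (sym (*-identityˡ _))) (*-monoˡ-≤ (b * b * (b * b)) 1≤lam)))
          i₁≤ : ∑ lines (cubeIf i₁) ≤ L
          i₁≤ = ≤-trans ∑i₁³≤ (*-monoʳ-≤ lam (*-mono-≤ (*-mono-≤ a≤b a≤b) (*-mono-≤ a≤b a≤b)))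
          e₁ : ∀ a b lam → a * a * (b * b) * (lam * (b * b * (b * b)) + lam * (b * b * (b * b)) + lam * (b * b * (b * b)))
               ≡ 3 * lam * (a * (b * b * b) * (a * (b * b * b)))
          e₁ = solve-∀
          e₂ : ∀ a b lam → 9 * (lam * lam) * (a * (b * b * b) * (a * (b * b * b))) ≡
               3 * lam * (a * (b * b * b)) * (3 * lam * (a * (b * b * b)))
          e₂ = solve-∀

        -- The critical term: c⁴ · a²b² · ab³ is a³b⁵c⁴, with nothing lost in the powers of `a`,
        -- `b`, `c`.
        B³≤ : B * B * B ≤ M
        B³≤ = begin
          B * B * B
            ≤⟨ hölder lines f³≤ ⟩
          ∑ lines (cubeIf i₃) * A * Z
            ≤⟨ *-mono-≤ (*-mono-≤ ∑i₃³≤ ∑p≤) Z≤ ⟩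
          lam * (c * c * (c * c)) * (a * a * (b * b)) * (3 * lam * (a * (b * b * b)))
            ≡⟨ e a b c lam ⟩
          3 * (lam * lam * 1) * D
            ≤⟨ *-monoˡ-≤ D (*-mono-≤ (m≤m+n 3 24) (*-monoʳ-≤ (lam * lam) 1≤lam)) ⟩
          M ∎
          where
          e : ∀ a b c lam → lam * (c * c * (c * c)) * (a * a * (b * b)) * (3 * lam * (a * (b * b * b))) ≡
              3 * (lam * lam * 1) * (a * a * a * (b * b * b * b * b) * (c * c * c * c))
          e = solve-∀

        -- Hölder gives a⁴b⁴c⁴, and one factor `a` is traded for `b`.
        C³≤ : C * C * C ≤ M
        C³≤ = begin
          C * C * C
            ≤⟨ hölder lines g³≤ ⟩
          ∑ lines (cubeIf i₁) * ∑ lines (cubeIf i₂) * ∑ lines (cubeIf i₃)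
            ≤⟨ *-mono-≤ (*-mono-≤ ∑i₁³≤ ∑i₂³≤) ∑i₃³≤ ⟩
          lam * (a * a * (a * a)) * (lam * (b * b * (b * b))) * (lam * (c * c * (c * c)))
            ≡⟨ e a b c lam ⟩
          1 * (lam * lam * lam) * (a * (a * a * a * (b * b * b * b) * (c * c * c * c)))
            ≤⟨ *-mono-≤ (*-monoˡ-≤ (lam * lam * lam) (s≤s (z≤n {26})))
                 (*-monoˡ-≤ (a * a * a * (b * b * b * b) * (c * c * c * c)) a≤b) ⟩
          27 * (lam * lam * lam) * (b * (a * a * a * (b * b * b * b) * (c * c * c * c)))
            ≡⟨ e′ a b c lam ⟩
          M ∎
          where
          e : ∀ a b c lam →
            lam * (a * a * (a * a)) * (lam * (b * b * (b * b))) * (lam * (c * c * (c * c))) ≡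
            1 * (lam * lam * lam) * (a * (a * a * a * (b * b * b * b) * (c * c * c * c)))
          e = solve-∀
          e′ : ∀ a b c lam →
            27 * (lam * lam * lam) * (b * (a * a * a * (b * b * b * b) * (c * c * c * c))) ≡
            27 * (lam * lam * lam) * (a * a * a * (b * b * b * b * b) * (c * c * c * c))
          e′ = solve-∀

      ∑-p·i₃-cube≤ : ∀ {t} → t ≤ ∑[ ℓ ∈ lines ] (p ℓ * i₃ ℓ) →
        t * t * t ≤ 9 * lam * (9 * lam) * (9 * lam) * D
      ∑-p·i₃-cube≤ {t} t≤ = begin
        t * t * t                               ≤⟨ cube-mono t≤A+B+C ⟩
        (A + B + C) * (A + B + C) * (A + B + C) ≤⟨ cube-+₃ {A} {B} {C} A³≤ B³≤ C³≤ ⟩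
        -- 27 comes from adding three terms and another 27 from `M`; their product is 9³.
        27 * M                                  ≡⟨ e lam D ⟩
        9 * lam * (9 * lam) * (9 * lam) * D     ∎
        where
        t≤A+B+C : t ≤ A + B + C
        t≤A+B+C = ≤-trans t≤ (≤-trans (∑-mono lines p·i₃≤) (≤-reflexive
          (trans (∑-+ lines _ g) (cong (_+ C) (∑-+ lines p f)))))
        e : ∀ lam D → 27 * (27 * (lam * lam * lam) * D) ≡ 9 * lam * (9 * lam) * (9 * lam) * D
        e = solve-∀

-- Collinear triples in three grids

module TripleCounting where
  open FiniteSums
  open GridLines
  open LineSums
  open import Data.Nat.Base using (ℕ; _+_; _*_; _≤_)
  open import Data.Nat.Properties
  open import Data.Nat.Logarithm using (⌊log₂_⌋)
  open import Data.Nat.Tactic.RingSolver using (solve-∀)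
  open import Data.List.Base using (List; length; cartesianProduct)
  open import Data.List.Membership.Propositional using (find)
  open import Data.List.Membership.Propositional.Properties using (∈-cartesianProduct⁺)
  open import Data.List.Relation.Unary.All as All using (All)
  open import Data.List.Relation.Unary.Any using (Any)
  open import Data.List.Relation.Unary.AllPairs as AllPairs using (AllPairs)
  open import Data.List.Relation.Unary.Unique.Propositional using (Unique)
  open import Data.Product.Base using (_×_; _,_; proj₁; proj₂)
  open import Relation.Binary.PropositionalEquality
    using (_≡_; refl; sym; trans; cong; cong₂; subst)
  open import Relation.Nullary.Decidable using (Dec; _×-dec_)
  open import Relation.Nullary.Negation using (¬_)

  -- Opaque, since unification would otherwise unfold multiplication by the literal.
  opaque
    constant : ℕ
    constant = 13824

    constant≡ : 9 * 1536 ≡ constant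
    constant≡ = refl

    3≤constant : 3 ≤ constant
    3≤constant = m≤m+n 3 13821

  -- Points of different grids have indices of different types, so being distinct across the first
  -- two grids enters as an abstract decidable relation.
  module CollinearTriples {Λ : Set} {a b c : ℕ}
    (I₁ : Incidence Λ a) (I₂ : Incidence Λ b) (I₃ : Incidence Λ c)
    {Distinct : Pt a → Pt b → Set} (distinct? : ∀ p q → Dec (Distinct p q)) where

    open Incidence I₁ using () renaming (On to On₁; on? to on₁?)
    open Incidence I₂ using () renaming (On to On₂; on? to on₂?)
    open Incidence I₃ using () renaming (On to On₃; on? to on₃?)
    module R₁ = RichLines I₁
    module R₂ = RichLines I₂
    module R₃ = RichLines I₃

    pair? : ∀ ℓ p q → Dec (Distinct p q × On₁ ℓ p × On₂ ℓ q)
    pair? ℓ p q = distinct? p q ×-dec on₁? ℓ p ×-dec on₂? ℓ q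

    #pairs : Λ → ℕ
    #pairs ℓ = ∑[ p ∈ pts a ] ∑[ q ∈ pts b ] 𝟙 (pair? ℓ p q)

    #pairs≤ : ∀ ℓ → #pairs ℓ ≤ R₁.#on ℓ * R₂.#on ℓ
    #pairs≤ ℓ = begin
      ∑[ p ∈ pts a ] ∑[ q ∈ pts b ] 𝟙 (pair? ℓ p q)
        ≤⟨ ∑-mono (pts a) (λ p → ∑-mono (pts b) (λ q → ≤-trans
             (𝟙-mono (pair? ℓ p q) (on₁? ℓ p ×-dec on₂? ℓ q) proj₂)
             (≤-reflexive (𝟙-× (on₁? ℓ p) (on₂? ℓ q))))) ⟩
      ∑[ p ∈ pts a ] ∑[ q ∈ pts b ] (𝟙 (on₁? ℓ p) * 𝟙 (on₂? ℓ q))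
        ≡⟨ ∑-product (pts a) (pts b) (λ p → 𝟙 (on₁? ℓ p)) (λ q → 𝟙 (on₂? ℓ q)) ⟩
      R₁.#on ℓ * R₂.#on ℓ ∎
      where open ≤-Reasoning

    Separated₁₂ : Λ → Λ → Set
    Separated₁₂ ℓ ℓ′ = ∀ {p q} → Distinct p q → On₁ ℓ p → On₂ ℓ q → On₁ ℓ′ p → ¬ On₂ ℓ′ q

    ∑-#pairs≤ : ∀ {lines} → AllPairs Separated₁₂ lines → ∑ lines #pairs ≤ a * a * (b * b)
    ∑-#pairs≤ {lines} separated = begin
      ∑[ ℓ ∈ lines ] ∑[ p ∈ pts a ] ∑[ q ∈ pts b ] 𝟙 (pair? ℓ p q)
        ≡⟨ trans (∑-swap lines (pts a) _) (∑-cong (pts a) λ p → ∑-swap lines (pts b) _) ⟩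
      ∑[ p ∈ pts a ] ∑[ q ∈ pts b ] ∑[ ℓ ∈ lines ] 𝟙 (pair? ℓ p q)
        ≤⟨ ∑-mono (pts a) (λ p → ∑-mono (pts b) (λ q → ∑-𝟙≤1 (λ ℓ → pair? ℓ p q)
             (AllPairs.map (λ { sep (d , x , y) (_ , x′ , y′) → sep d x y x′ y′ }) separated))) ⟩
      ∑[ p ∈ pts a ] ∑[ q ∈ pts b ] 1
        ≡⟨ trans (∑-product (pts a) (pts b) (λ _ → 1) (λ _ → 1)) (cong₂ _*_ (size a) (size b)) ⟩
      a * a * (b * b) ∎
      where
      open ≤-Reasoning
      size : ∀ n → ∑[ _ ∈ pts n ] 1 ≡ n * n
      size n = trans (∑-const (pts n) 1) (trans (*-identityʳ _) (length-pts n))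

    OnCommonLine : List Λ → Pt a × Pt b × Pt c → Set
    OnCommonLine lines (p , q , r) = Distinct p q × Any (λ ℓ → On₁ ℓ p × On₂ ℓ q × On₃ ℓ r) lines

    -- Each triple is hit by at least one line of the list; for a fixed line the pair and the third
    -- point are chosen independently, which gives the product.
    #triples≤ : ∀ {lines zs} → Unique zs → All (OnCommonLine lines) zs →
                length zs ≤ ∑[ ℓ ∈ lines ] (#pairs ℓ * R₃.#on ℓ)
    #triples≤ {lines} {zs} zs-unique good = begin
      length zs
        ≤⟨ length≤∑ (All.map one≤ good) ⟩
      ∑[ z ∈ zs ] ∑[ ℓ ∈ lines ] hit ℓ z
        ≤⟨ ∑-⊆ (λ z → ∑[ ℓ ∈ lines ] hit ℓ z) zs-unique
             (λ {z} _ → ∈-cartesianProduct⁺ (∈-pts (proj₁ z))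
                (∈-cartesianProduct⁺ (∈-pts (proj₁ (proj₂ z))) (∈-pts (proj₂ (proj₂ z))))) ⟩
      ∑[ z ∈ triples ] ∑[ ℓ ∈ lines ] hit ℓ z
        ≡⟨ ∑-swap triples lines _ ⟩
      ∑[ ℓ ∈ lines ] ∑[ z ∈ triples ] hit ℓ z
        ≡⟨ ∑-cong lines factor ⟩
      ∑[ ℓ ∈ lines ] (#pairs ℓ * R₃.#on ℓ) ∎
      where
      open ≤-Reasoning
      triples : List (Pt a × Pt b × Pt c)
      triples = cartesianProduct (pts a) (cartesianProduct (pts b) (pts c))
      hit : Λ → Pt a × Pt b × Pt c → ℕ
      hit ℓ (p , q , r) = 𝟙 (pair? ℓ p q) * 𝟙 (on₃? ℓ r)
      one≤ : ∀ {z} → OnCommonLine lines z → 1 ≤ ∑[ ℓ ∈ lines ] hit ℓ z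
      one≤ {z@(p , q , r)} (d , any) with find any
      ... | ℓ , ℓ∈lines , x , y , w = ≤-trans
        (≤-reflexive (sym (cong₂ _*_ (𝟙-yes (pair? ℓ p q) (d , x , y)) (𝟙-yes (on₃? ℓ r) w))))
        (∈⇒≤∑ (λ ℓ → hit ℓ z) ℓ∈lines)
      factor : ∀ ℓ → ∑ triples (hit ℓ) ≡ #pairs ℓ * R₃.#on ℓ
      factor ℓ = trans (∑-cartesianProduct (pts a) (cartesianProduct (pts b) (pts c)) (hit ℓ))
        (trans (∑-cong (pts a) (λ p → trans
            (∑-cartesianProduct (pts b) (pts c) (λ { (q , r) → hit ℓ (p , q , r) }))
            (∑-product (pts b) (pts c) (λ q → 𝟙 (pair? ℓ p q)) (λ r → 𝟙 (on₃? ℓ r)))))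
          (∑-*ʳ (pts a) (λ p → ∑[ q ∈ pts b ] 𝟙 (pair? ℓ p q)) (R₃.#on ℓ)))

    #triples-cube≤ : ∀ {lines zs L} → a ≤ b → b ≤ c →
      1 ≤ L → 2 + ⌊log₂ a ⌋ ≤ 3 * L → 2 + ⌊log₂ b ⌋ ≤ 3 * L → 2 + ⌊log₂ c ⌋ ≤ 3 * L →
      AllPairs R₁.Separated lines → AllPairs R₂.Separated lines → AllPairs R₃.Separated lines →
      AllPairs Separated₁₂ lines → Unique zs → All (OnCommonLine lines) zs →
      length zs * length zs * length zs ≤
      constant * L * (constant * L) * (constant * L) * (a * a * a * (b * b * b * b * b) * (c * c * c * c))
    #triples-cube≤ {lines} {zs} {L} a≤b b≤c 1≤L la lb lc s₁ s₂ s₃ s₁₂ u good =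
      subst (λ K → length zs * length zs * length zs ≤ K * K * K * D)
        (trans (sym (*-assoc 9 1536 L)) (cong (_* L) constant≡))
        -- 1536 = 3 · 512: the 512 of `∑-cubeIfRich≤` times the 3 from comparing its logarithmic
        -- factor with `L`.
        (∑-p·i₃-cube≤ lines R₁.#on R₂.#on R₃.#on #pairs #pairs≤ {lam = 1536 * L} a≤b b≤c
          (≤-trans 1≤L (m≤n*m L 1536))
          (∑-#pairs≤ s₁₂)
          (≤-trans (R₁.∑-cubeIfRich≤ s₁) (scale a la))
          (≤-trans (R₂.∑-cubeIfRich≤ s₂) (scale b lb))
          (≤-trans (R₃.∑-cubeIfRich≤ s₃) (scale c lc))
          (#triples≤ u good))
      where
      D = a * a * a * (b * b * b * b * b) * (c * c * c * c)
      e : ∀ L n → 3 * L * (512 * (n * n * (n * n))) ≡ 1536 * L * (n * n * (n * n))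
      e = solve-∀
      scale : ∀ n → 2 + ⌊log₂ n ⌋ ≤ 3 * L →
              (2 + ⌊log₂ n ⌋) * (512 * (n * n * (n * n))) ≤ 1536 * L * (n * n * (n * n))
      scale n h = ≤-trans (*-monoˡ-≤ (512 * (n * n * (n * n))) h) (≤-reflexive (e L n))

-- Order and lines in the real plane

module RealGeometry where
  import Defs as D
  open import Defs hiding (_+_; _*_; _-_; -_; 0ℝ)
  open import Data.Fin.Base using (Fin)
  open import Data.Nat.Base as ℕ using (ℕ)
  import Data.Nat.Properties as ℕ
  open import Data.Product.Base using (_,_; proj₁; proj₂)
  open import Data.Rational.Base as ℚ using (ℚ; 0ℚ; ½)
  import Data.Rational.Properties as ℚ
  open import Data.Rational.Solver using (module +-*-Solver)
  open import Data.Sum.Base using (_⊎_; inj₁; inj₂)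
  open import Data.Vec.Base as Vec using (Vec; lookup)
  open import Data.Vec.Properties using (lookup-map)
  open import Relation.Binary.Bundles using (Setoid)
  open import Relation.Binary.PropositionalEquality
    using (_≡_; refl; sym; trans; cong; cong₂; subst; subst₂; _→-setoid_)
  import Relation.Binary.Reflection as Reflection
  open import Relation.Nullary.Negation using (¬_)

  module ≈ = Setoid ℝ-setoid
  module ≈ₚ = Setoid Point-setoid

  -- Unfolding the operations on ℝ down to those on ℚ makes conversion checking
  -- intractable, hence these opaque copies.
  opaque
    infixl 6 _+_ _-_
    infixl 7 _*_

    0ℝ : ℝ
    0ℝ = D.0ℝ

    _+_ _*_ _-_ : ℝ → ℝ → ℝ
    x + y = x D.+ y
    x * y = x D.* y
    x - y = x D.- y

    -_ : ℝ → ℝ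
    - x = D.- x

    0≡ : 0ℝ ≡ D.0ℝ
    0≡ = refl

    +≡ : ∀ x y → x + y ≡ x D.+ y
    +≡ _ _ = refl

    *≡ : ∀ x y → x * y ≡ x D.* y
    *≡ _ _ = refl

    -≡ : ∀ x y → x - y ≡ x D.- y
    -≡ _ _ = refl

    seq-0 : ∀ n → seq 0ℝ n ≡ 0ℚ
    seq-0 _ = refl

    seq-+ : ∀ x y n → seq (x + y) n ≡ seq x n ℚ.+ seq y n
    seq-+ _ _ _ = refl

    seq-* : ∀ x y n → seq (x * y) n ≡ seq x n ℚ.* seq y n
    seq-* _ _ _ = refl

    seq-- : ∀ x y n → seq (x - y) n ≡ seq x n ℚ.- seq y n
    seq-- _ _ _ = refl

    seq-neg : ∀ x n → seq (- x) n ≡ ℚ.- seq x n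
    seq-neg _ _ = refl

  private
    module Rational where
      open +-*-Solver

      *-mono-≤ : ∀ {p q r s} → 0ℚ ℚ.≤ p → p ℚ.≤ q → 0ℚ ℚ.≤ r → r ℚ.≤ s → p ℚ.* r ℚ.≤ q ℚ.* s
      *-mono-≤ {p} {q} {r} {s} 0≤p p≤q 0≤r r≤s = ℚ.≤-trans
        (ℚ.*-monoʳ-≤-nonNeg r {{ℚ.nonNegative 0≤r}} p≤q)
        (ℚ.*-monoˡ-≤-nonNeg q {{ℚ.nonNegative (ℚ.≤-trans 0≤p p≤q)}} r≤s)

      square-nonNeg : ∀ p → 0ℚ ℚ.≤ p ℚ.* p
      square-nonNeg p with ℚ.≤-total 0ℚ p
      ... | inj₁ 0≤p = *-mono-≤ ℚ.≤-refl 0≤p ℚ.≤-refl 0≤p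
      ... | inj₂ p≤0 = subst (0ℚ ℚ.≤_) (solve 1 (λ p → (:- p) :* (:- p) := p :* p) refl p)
        (*-mono-≤ ℚ.≤-refl (ℚ.neg-antimono-≤ p≤0) ℚ.≤-refl (ℚ.neg-antimono-≤ p≤0))

      p≤∣p∣ : ∀ p → p ℚ.≤ ℚ.∣ p ∣
      p≤∣p∣ p with ℚ.≤-total 0ℚ p
      ... | inj₁ 0≤p = ℚ.≤-reflexive (sym (ℚ.0≤p⇒∣p∣≡p 0≤p))
      ... | inj₂ p≤0 = ℚ.≤-trans p≤0 (ℚ.0≤∣p∣ p)

      half+half : ∀ ε → ½ ℚ.* ε ℚ.+ ½ ℚ.* ε ≡ ε
      half+half ε = trans (sym (ℚ.*-distribʳ-+ ε ½ ½)) (ℚ.*-identityˡ ε)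

      half<self : ∀ {δ} → 0ℚ ℚ.< δ → ½ ℚ.* δ ℚ.< δ
      half<self {δ} 0<δ = subst₂ ℚ._<_ (ℚ.+-identityʳ (½ ℚ.* δ)) (half+half δ)
        (ℚ.+-monoʳ-< (½ ℚ.* δ) (half-pos 0<δ))

      close-≥ : ∀ {p q ε δ} → ℚ.∣ p ℚ.- q ∣ ℚ.< δ → ε ℚ.+ δ ℚ.≤ p → ε ℚ.≤ q
      close-≥ {p} {q} {ε} {δ} h ε+δ≤p = ℚ.≮⇒≥ λ q<ε → ℚ.<-irrefl refl (begin-strict
        p                  ≡⟨ solve 2 (λ p q → p := q :+ (p :- q)) refl p q ⟩
        q ℚ.+ (p ℚ.- q)    <⟨ ℚ.+-mono-< q<ε (ℚ.≤-<-trans (p≤∣p∣ (p ℚ.- q)) h) ⟩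
        ε ℚ.+ δ            ≤⟨ ε+δ≤p ⟩
        p                  ∎)
        where open ℚ.≤-Reasoning

      dist-neg : ∀ p q → ℚ.∣ p ℚ.- q ∣ ≡ ℚ.∣ ℚ.- p ℚ.- ℚ.- q ∣
      dist-neg p q = trans (dist-sym p q)
        (cong ℚ.∣_∣ (solve 2 (λ p q → q :- p := (:- p) :- (:- q)) refl p q))

      ∣p∣< : ∀ {p δ} → p ℚ.< δ → ℚ.- p ℚ.< δ → ℚ.∣ p ∣ ℚ.< δ
      ∣p∣< {p} {δ} p<δ -p<δ with ℚ.∣p∣≡p∨∣p∣≡-p p
      ... | inj₁ e = subst (ℚ._< δ) (sym e) p<δ
      ... | inj₂ e = subst (ℚ._< δ) (sym e) -p<δ

      ∣q∣<sum : ∀ {p q ε δ} → ℚ.∣ q ℚ.- p ∣ ℚ.< ε → ℚ.∣ p ∣ ℚ.< δ → ℚ.∣ q ∣ ℚ.< ε ℚ.+ δ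
      ∣q∣<sum {p} {q} {ε} {δ} h k = subst (λ s → ℚ.∣ s ∣ ℚ.< ε ℚ.+ δ)
        (solve 2 (λ a b → (b :- a) :+ a := b) refl p q)
        (ℚ.≤-<-trans (ℚ.∣p+q∣≤∣p∣+∣q∣ (q ℚ.- p) p) (ℚ.+-mono-< h k))

    open Rational

  -- A solver for polynomial identities, which hold termwise

  infixl 7 _:*_
  infixl 6 _:+_ _:-_
  infix  8 :-_

  data Expr (k : ℕ) : Set where
    var            : Fin k → Expr k
    :0             : Expr k
    _:+_ _:*_ _:-_ : Expr k → Expr k → Expr k
    :-_            : Expr k → Expr k

  ⟦_⟧ : ∀ {k} → Expr k → Vec ℝ k → ℝ
  ⟦ var i  ⟧ ρ = lookup ρ i
  ⟦ :0     ⟧ ρ = 0ℝ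
  ⟦ e :+ f ⟧ ρ = ⟦ e ⟧ ρ + ⟦ f ⟧ ρ
  ⟦ e :* f ⟧ ρ = ⟦ e ⟧ ρ * ⟦ f ⟧ ρ
  ⟦ e :- f ⟧ ρ = ⟦ e ⟧ ρ - ⟦ f ⟧ ρ
  ⟦ :- e   ⟧ ρ = - ⟦ e ⟧ ρ

  module P = +-*-Solver

  polynomial : ∀ {k} → Expr k → P.Polynomial k
  polynomial (var i)  = P.var i
  polynomial :0       = P.con 0ℚ
  polynomial (e :+ f) = polynomial e P.:+ polynomial f
  polynomial (e :* f) = polynomial e P.:* polynomial f
  polynomial (e :- f) = polynomial e P.:- polynomial f
  polynomial (:- e)   = P.:- polynomial e

  seq-⟦⟧ : ∀ {k} (e : Expr k) ρ n →
           P.⟦ polynomial e ⟧ (Vec.map (λ x → seq x n) ρ) ≡ seq (⟦ e ⟧ ρ) n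
  seq-⟦⟧ (var i)  ρ n = lookup-map i (λ x → seq x n) ρ
  seq-⟦⟧ :0       ρ n = sym (seq-0 n)
  seq-⟦⟧ (e :+ f) ρ n = trans (cong₂ ℚ._+_ (seq-⟦⟧ e ρ n) (seq-⟦⟧ f ρ n)) (sym (seq-+ _ _ n))
  seq-⟦⟧ (e :* f) ρ n = trans (cong₂ ℚ._*_ (seq-⟦⟧ e ρ n) (seq-⟦⟧ f ρ n)) (sym (seq-* _ _ n))
  seq-⟦⟧ (e :- f) ρ n = trans (cong₂ ℚ._-_ (seq-⟦⟧ e ρ n) (seq-⟦⟧ f ρ n)) (sym (seq-- _ _ n))
  seq-⟦⟧ (:- e)   ρ n = trans (cong ℚ.-_ (seq-⟦⟧ e ρ n)) (sym (seq-neg _ n))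

  open Reflection (ℕ →-setoid ℚ) var (λ e ρ → seq (⟦ e ⟧ ρ))
    (λ e ρ n → P.⟦ polynomial e ⟧↓ (Vec.map (λ x → seq x n) ρ))
    (λ e ρ n → trans (P.correct (polynomial e) (Vec.map (λ x → seq x n) ρ)) (seq-⟦⟧ e ρ n))
    using (solve; _⊜_)

  -- Vanishing and positivity of reals

  private
    variable
      x y z w : ℝ

  -- ≈ unfolds to a statement about sequences, from which the two reals cannot be
  -- inferred; the records below keep them visible to unification.
  record Null (x : ℝ) : Set where
    constructor null
    field ≈0 : x ≈ 0ℝ

  record Pos (x : ℝ) : Set where
    constructor pos
    field
      gap    : ℚ
      start  : ℕ
      0<gap  : 0ℚ ℚ.< gap
      gap≤   : ∀ n → start ℕ.≤ n → gap ℚ.≤ seq x n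

  -- A property of the representing sequence, not invariant under `_≈_`. It serves for summands
  -- added to a positive real.
  record NonNeg (x : ℝ) : Set where
    constructor nonNeg
    field
      start : ℕ
      0≤    : ∀ n → start ℕ.≤ n → 0ℚ ℚ.≤ seq x n

  open Null public

  opaque
    unfolding _+_

    -- The passage from a termwise identity found by the solver to the reals.
    null-pointwise : (∀ n → seq z n ≡ seq x n) → Null x → Null z
    null-pointwise h (null x≈0) = null λ ε 0<ε → let (N , f) = x≈0 ε 0<ε in
      N , λ n N≤n → subst (λ s → ℚ.∣ s ℚ.- 0ℚ ∣ ℚ.< ε) (sym (h n)) (f n N≤n)

    ≈⇒null : x ≈ y → Null (x - y)
    ≈⇒null {x} {y} h = null λ ε 0<ε → let (N , f) = h ε 0<ε in N , λ n N≤n →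
      subst (λ s → ℚ.∣ s ∣ ℚ.< ε) (sym (ℚ.+-identityʳ (seq x n ℚ.- seq y n))) (f n N≤n)

    null⇒≈ : Null (x - y) → x ≈ y
    null⇒≈ {x} {y} (null h) ε 0<ε = let (N , f) = h ε 0<ε in N , λ n N≤n →
      subst (λ s → ℚ.∣ s ∣ ℚ.< ε) (ℚ.+-identityʳ (seq x n ℚ.- seq y n)) (f n N≤n)

    null-+ : Null x → Null y → Null (x + y)
    null-+ {x} {y} (null hx) (null hy) = null λ ε 0<ε →
      let (M , f) = hx (½ ℚ.* ε) (half-pos 0<ε)
          (N , g) = hy (½ ℚ.* ε) (half-pos 0<ε)
      in M ℕ.⊔ N , λ n le → ℚ.≤-<-trans
        (subst (λ s → ℚ.∣ s ∣ ℚ.≤ ℚ.∣ seq x n ℚ.- 0ℚ ∣ ℚ.+ ℚ.∣ seq y n ℚ.- 0ℚ ∣)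
          (trans (cong₂ ℚ._+_ (ℚ.+-identityʳ (seq x n)) (ℚ.+-identityʳ (seq y n))) (sym (ℚ.+-identityʳ _)))
          (ℚ.∣p+q∣≤∣p∣+∣q∣ (seq x n ℚ.- 0ℚ) (seq y n ℚ.- 0ℚ)))
        (halves (f n (ℕ.m⊔n≤o⇒m≤o M N le)) (g n (ℕ.m⊔n≤o⇒n≤o M N le)))

    null-* : ∀ c → Null x → Null (c * x)
    null-* {x} c (null h) = null λ ε 0<ε →
      let (B , K , 0<B , bc) = eventuallyBounded c
          (δ , 0<δ , total)  = split B ε 0<B 0<ε
          (N , f) = h δ 0<δ
      in K ℕ.⊔ N , λ n le → subst₂ (λ s t → ℚ.∣ s ∣ ℚ.< t)
        (sym (ℚ.+-identityʳ (seq c n ℚ.* seq x n))) total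
        (*-small (seq c n) (seq x n) 0<B (bc n (ℕ.m⊔n≤o⇒m≤o K N le))
          (subst (λ s → ℚ.∣ s ∣ ℚ.< δ) (ℚ.+-identityʳ (seq x n)) (f n (ℕ.m⊔n≤o⇒n≤o K N le))))

    null-neg : Null x → Null (- x)
    null-neg {x} (null h) = null λ ε 0<ε → let (N , f) = h ε 0<ε in N , λ n N≤n →
      subst (ℚ._< ε) (e (seq x n)) (f n N≤n)
      where
      e : ∀ p → ℚ.∣ p ℚ.- 0ℚ ∣ ≡ ℚ.∣ ℚ.- p ℚ.- 0ℚ ∣
      e p = trans (cong ℚ.∣_∣ (ℚ.+-identityʳ p))
        (trans (sym (ℚ.∣-p∣≡∣p∣ p)) (cong ℚ.∣_∣ (sym (ℚ.+-identityʳ (ℚ.- p)))))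

    null-- : Null x → Null y → Null (x - y)
    null-- hx hy = null-+ hx (null-neg hy)

  null⇒≈0 : Null x → x ≈ D.0ℝ
  null⇒≈0 {x} (null h) = subst (x ≈_) 0≡ h

  ≈0⇒null : x ≈ D.0ℝ → Null x
  ≈0⇒null {x} h = null (subst (x ≈_) (sym 0≡) h)

  null-0 : Null 0ℝ
  null-0 = null (≈.refl {0ℝ})

  infix 4 _<_
  _<_ : ℝ → ℝ → Set
  x < y = Pos (y - x)

  opaque
    unfolding _+_

    pos⇒nonNeg : Pos x → NonNeg x
    pos⇒nonNeg (pos ε N 0<ε f) = nonNeg N λ n N≤n → ℚ.≤-trans (ℚ.<⇒≤ 0<ε) (f n N≤n)

    pos-+ : Pos x → NonNeg y → Pos (x + y)
    pos-+ {x} {y} (pos ε M 0<ε f) (nonNeg N g) = pos ε (M ℕ.⊔ N) 0<ε λ n le →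
      subst (ℚ._≤ seq x n ℚ.+ seq y n) (ℚ.+-identityʳ ε)
        (ℚ.+-mono-≤ (f n (ℕ.m⊔n≤o⇒m≤o M N le)) (g n (ℕ.m⊔n≤o⇒n≤o M N le)))

    pos-* : Pos x → Pos y → Pos (x * y)
    pos-* {x} {y} (pos ε M 0<ε f) (pos δ N 0<δ g) = pos (ε ℚ.* δ) (M ℕ.⊔ N)
      (ℚ.positive⁻¹ _ {{ℚ.pos*pos⇒pos ε {{ℚ.positive 0<ε}} δ {{ℚ.positive 0<δ}}}})
      λ n le → *-mono-≤ (ℚ.<⇒≤ 0<ε) (f n (ℕ.m⊔n≤o⇒m≤o M N le))
                        (ℚ.<⇒≤ 0<δ) (g n (ℕ.m⊔n≤o⇒n≤o M N le))

    square*-nonNeg : ∀ c → NonNeg x → NonNeg (c * c * x)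
    square*-nonNeg c (nonNeg N f) = nonNeg N λ n N≤n →
      *-mono-≤ ℚ.≤-refl (square-nonNeg (seq c n)) ℚ.≤-refl (f n N≤n)

    pos⇒¬null : Pos x → ¬ Null x
    pos⇒¬null {x} (pos ε M 0<ε f) (null h) =
      let (N , g) = h ε 0<ε
          n = M ℕ.⊔ N
      in ℚ.<-irrefl refl (ℚ.<-≤-trans (subst (λ s → ℚ.∣ s ∣ ℚ.< ε) (ℚ.+-identityʳ (seq x n)) (g n (ℕ.m≤n⊔m M N)))
           (ℚ.≤-trans (f n (ℕ.m≤m⊔n M N)) (p≤∣p∣ (seq x n))))

    -- Half of the gap survives once the sequences differ by less than the other half.
    pos-resp : Null (x - y) → Pos x → Pos y
    pos-resp {x} {y} (null h) (pos ε M 0<ε f) =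
      let (N , g) = h (½ ℚ.* ε) (half-pos 0<ε)
      in pos (½ ℚ.* ε) (M ℕ.⊔ N) (half-pos 0<ε) λ n le → close-≥
        (subst (λ s → ℚ.∣ s ∣ ℚ.< ½ ℚ.* ε) (ℚ.+-identityʳ (seq x n ℚ.- seq y n))
          (g n (ℕ.m⊔n≤o⇒n≤o M N le)))
        (subst (ℚ._≤ seq x n) (sym (half+half ε)) (f n (ℕ.m⊔n≤o⇒m≤o M N le)))

  -- Trichotomy in negative form, proved without excluded middle. From an index `N` on, the sequence
  -- varies by less than δ/2; a term of absolute value at least δ at `N` would make `x` or `- x`
  -- positive with gap δ/2.
  module _ (x : ℝ) (¬pos : ¬ Pos x) (¬neg : ¬ Pos (- x)) where

    private
      module _ {δ} (0<δ : 0ℚ ℚ.< δ) {N}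
        (f : ∀ m n → N ℕ.≤ m → N ℕ.≤ n → ℚ.∣ seq x m ℚ.- seq x n ∣ ℚ.< ½ ℚ.* δ) where

        xN<δ : seq x N ℚ.< δ
        xN<δ = ℚ.≰⇒> λ δ≤xN → ¬pos (pos (½ ℚ.* δ) N (half-pos 0<δ) λ n N≤n →
          close-≥ (f N n ℕ.≤-refl N≤n) (subst (ℚ._≤ seq x N) (sym (half+half δ)) δ≤xN))

        opaque
          unfolding _+_

          -xN<δ : ℚ.- seq x N ℚ.< δ
          -xN<δ = ℚ.≰⇒> λ δ≤-xN → ¬neg (pos (½ ℚ.* δ) N (half-pos 0<δ) λ n N≤n →
            close-≥ (subst (ℚ._< ½ ℚ.* δ) (dist-neg (seq x N) (seq x n)) (f N n ℕ.≤-refl N≤n))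
              (subst (ℚ._≤ ℚ.- seq x N) (sym (half+half δ)) δ≤-xN))

        small : ∀ n → N ℕ.≤ n → ℚ.∣ seq x n ∣ ℚ.< δ ℚ.+ δ
        small n N≤n = ∣q∣<sum (ℚ.<-trans (f n N N≤n ℕ.≤-refl) (half<self 0<δ)) (∣p∣< xN<δ -xN<δ)

    opaque
      unfolding _+_

      ¬pos⇒null : Null x
      ¬pos⇒null = null λ ε 0<ε → let (N , f) = cauchy x (½ ℚ.* (½ ℚ.* ε)) (half-pos (half-pos 0<ε)) in
        N , λ n N≤n → subst₂ (λ s t → ℚ.∣ s ∣ ℚ.< t) (sym (ℚ.+-identityʳ (seq x n))) (half+half ε)
          (small (half-pos 0<ε) f n N≤n)

  -- Being zero is equivalent to not being positive or negative, hence to a negation. Equalities may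
  -- therefore be proved by contradiction.
  null-stable : ¬ ¬ Null x → Null x
  null-stable {x} ¬¬null = ¬pos⇒null x (λ p → ¬¬null (pos⇒¬null p))
    (λ p → ¬¬null (λ h → pos⇒¬null p (null-neg h)))

  -- A sign of `y` would exclude both signs of `x`, since products of positives are positive, and so
  -- force `x` to vanish.
  null-cancel : Null (x * y) → ¬ Null x → Null y
  null-cancel {x} {y} xy≈0 x≉0 = ¬pos⇒null y
    (λ p → x≉0 (¬pos⇒null x
      (λ q → pos⇒¬null (pos-* q p) xy≈0)
      (λ q → pos⇒¬null (pos-* q p) (null-pointwise {x = - (x * y)}
        (solve 2 (λ a b → (:- a) :* b ⊜ :- (a :* b)) (λ _ → refl) x y) (null-neg xy≈0)))))
    (λ p → x≉0 (¬pos⇒null x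
      (λ q → pos⇒¬null (pos-* q p) (null-pointwise {x = - (x * y)}
        (solve 2 (λ a b → a :* (:- b) ⊜ :- (a :* b)) (λ _ → refl) x y) (null-neg xy≈0)))
      (λ q → pos⇒¬null (pos-* q p) (null-pointwise {x = x * y}
        (solve 2 (λ a b → (:- a) :* (:- b) ⊜ a :* b) (λ _ → refl) x y) xy≈0))))

  null-cancelʳ : Null (x * y) → ¬ Null y → Null x
  null-cancelʳ {x} {y} xy≈0 = null-cancel (null-pointwise {y * x} {x * y}
    (solve 2 (λ x y → y :* x ⊜ x :* y) (λ _ → refl) x y) xy≈0)

  <-trans : x < y → y < z → x < z
  <-trans {x} {y} {z} p q = pos-resp
    (null-pointwise {x = 0ℝ} (solve 3 (λ a b c → ((b :- a) :+ (c :- b)) :- (c :- a) ⊜ :0) (λ _ → refl)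
      x y z) null-0)
    (pos-+ p (pos⇒nonNeg q))

  ≉⇒¬¬<> : ¬ x ≈ y → ¬ ¬ (x < y ⊎ y < x)
  ≉⇒¬¬<> {x} {y} x≉y k = x≉y (null⇒≈ {x} {y} (¬pos⇒null (x - y) (λ p → k (inj₂ p))
    (λ p → k (inj₁ (pos-resp (null-pointwise {x = 0ℝ}
      (solve 2 (λ a b → (:- (a :- b)) :- (b :- a) ⊜ :0) (λ _ → refl) x y)
      null-0) p)))))

  -- `_liesOn_` restated with the opaque operations as the vanishing of a residual, the form suited
  -- to the solver.
  _onLine_ : Point → Line → Set
  (x , y) onLine ℓ = Null (α * x + β * y - γ)
    where open Line ℓ

  private
    line-lhs≡ : ∀ ℓ x y → Line.α ℓ * x + Line.β ℓ * y ≡ Line.α ℓ D.* x D.+ Line.β ℓ D.* y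
    line-lhs≡ ℓ x y = trans (+≡ (α * x) (β * y))
      (cong₂ D._+_ {α * x} {α D.* x} {β * y} {β D.* y} (*≡ α x) (*≡ β y))
      where open Line ℓ

  liesOn⇒onLine : ∀ {p} ℓ → p liesOn ℓ → p onLine ℓ
  liesOn⇒onLine {x , y} ℓ h = subst (λ s → Null (s - γ)) (sym (line-lhs≡ ℓ x y))
    (≈⇒null {α D.* x D.+ β D.* y} {γ} h)
    where open Line ℓ

  onLine⇒liesOn : ∀ {p} ℓ → p onLine ℓ → p liesOn ℓ
  onLine⇒liesOn {x , y} ℓ h = subst (_≈ γ) (line-lhs≡ ℓ x y) (null⇒≈ {α * x + β * y} {γ} h)
    where open Line ℓ

  onLine-resp : ∀ {p q} ℓ → ≈ₚ._≈_ p q → p onLine ℓ → q onLine ℓ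
  onLine-resp {px , py} {qx , qy} ℓ (ex , ey) h = null-pointwise
    (solve 7 (λ a b c px py qx qy → a :* qx :+ b :* qy :- c ⊜
        ((a :* px :+ b :* py :- c) :- a :* (px :- qx)) :- b :* (py :- qy)) (λ _ → refl)
      α β γ px py qx qy)
    (null-- (null-- h (null-* α (≈⇒null {px} {qx} ex))) (null-* β (≈⇒null {py} {qy} ey)))
    where open Line ℓ

  module _ (ℓ ℓ′ : Line) {u v : Point} (u≉v : u ≉ₚ v)
    (uℓ : u onLine ℓ) (vℓ : v onLine ℓ) (uℓ′ : u onLine ℓ′) (vℓ′ : v onLine ℓ′) where
    open Line ℓ
    open Line ℓ′ using () renaming (α to α′; β to β′; γ to γ′)

    private
      -- The determinant of the two normals. By Cramer's rule it annihilates both coordinates of u -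
      -- v, so it vanishes when `u` and `v` differ.
      det : ℝ
      det = α * β′ - α′ * β
      ux = proj₁ u
      uy = proj₂ u
      vx = proj₁ v
      vy = proj₂ v

      det·dx≈0 : Null (det * (ux - vx))
      det·dx≈0 = null-pointwise
        (solve 10 (λ a b c a′ b′ c′ ux uy vx vy → (a :* b′ :- a′ :* b) :* (ux :- vx) ⊜
          (b′ :* (a :* ux :+ b :* uy :- c) :- b′ :* (a :* vx :+ b :* vy :- c)) :-
          (b :* (a′ :* ux :+ b′ :* uy :- c′) :- b :* (a′ :* vx :+ b′ :* vy :- c′))) (λ _ → refl)
          α β γ α′ β′ γ′
          ux uy vx vy)
        (null-- (null-- (null-* β′ uℓ) (null-* β′ vℓ)) (null-- (null-* β uℓ′) (null-* β vℓ′)))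

      det·dy≈0 : Null (det * (uy - vy))
      det·dy≈0 = null-pointwise
        (solve 10 (λ a b c a′ b′ c′ ux uy vx vy → (a :* b′ :- a′ :* b) :* (uy :- vy) ⊜
          (a :* (a′ :* ux :+ b′ :* uy :- c′) :- a :* (a′ :* vx :+ b′ :* vy :- c′)) :-
          (a′ :* (a :* ux :+ b :* uy :- c) :- a′ :* (a :* vx :+ b :* vy :- c))) (λ _ → refl)
          α β γ α′ β′ γ′
          ux uy vx vy)
        (null-- (null-- (null-* α uℓ′) (null-* α vℓ′)) (null-- (null-* α′ uℓ) (null-* α′ vℓ)))

      det≈0 : Null det
      det≈0 = null-stable λ det≉0 → u≉v
        (null⇒≈ {ux} {vx} (null-cancel det·dx≈0 det≉0) , null⇒≈ {uy} {vy} (null-cancel det·dy≈0 det≉0))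

    -- The normals are parallel and `u` is common, so both `α` and `β` annihilate the residual of
    -- `w` at `ℓ′`; were it nonzero, `ℓ` would be degenerate.
    two-points⇒⊆ : ∀ w → w onLine ℓ → w onLine ℓ′
    two-points⇒⊆ (wx , wy) wℓ = null-stable λ z≉0 → nondegenerate
      ( null⇒≈0 (null-cancelʳ {α} {α′ * wx + β′ * wy - γ′} (null-pointwise
          (solve 10 (λ a b c a′ b′ c′ ux uy wx wy → a :* (a′ :* wx :+ b′ :* wy :- c′) ⊜
            ((a′ :* (a :* wx :+ b :* wy :- c) :- a′ :* (a :* ux :+ b :* uy :- c)) :+
              (wy :- uy) :* (a :* b′ :- a′ :* b)) :+ a :* (a′ :* ux :+ b′ :* uy :- c′)) (λ _ → refl)
            α β γ α′ β′ γ′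
            ux uy wx wy)
          (null-+ (null-+ (null-- (null-* α′ wℓ) (null-* α′ uℓ)) (null-* (wy - uy) det≈0)) (null-* α uℓ′))) z≉0)
      , null⇒≈0 (null-cancelʳ {β} {α′ * wx + β′ * wy - γ′} (null-pointwise
          (solve 10 (λ a b c a′ b′ c′ ux uy wx wy → b :* (a′ :* wx :+ b′ :* wy :- c′) ⊜
            ((b′ :* (a :* wx :+ b :* wy :- c) :- b′ :* (a :* ux :+ b :* uy :- c)) :-
              (wx :- ux) :* (a :* b′ :- a′ :* b)) :+ b :* (a′ :* ux :+ b′ :* uy :- c′)) (λ _ → refl)
            α β γ α′ β′ γ′
            ux uy wx wy)
          (null-+ (null-- (null-- (null-* β′ wℓ) (null-* β′ uℓ)) (null-* (wx - ux) det≈0)) (null-* β uℓ′))) z≉0))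

  module _ (ℓ : Line) where
    open Line ℓ

    RisesOn FallsOn : Set
    RisesOn = ∀ {p q} → p onLine ℓ → q onLine ℓ → proj₁ p < proj₁ q → ¬ proj₂ q < proj₂ p
    FallsOn = ∀ {p q} → p onLine ℓ → q onLine ℓ → proj₁ p < proj₁ q → ¬ proj₂ p < proj₂ q

    private
      -- Along the line αΔx + βΔy = 0. Multiplying by `β` makes the coefficient of Δy a square, so
      -- the sign of αβ alone decides the direction.
      square-absurd : ∀ {κ d e} → Pos κ → Pos d → Pos e → ¬ Null (κ * d + β * β * e)
      square-absurd κ>0 d>0 e>0 =
        pos⇒¬null (pos-+ (pos-* κ>0 d>0) (square*-nonNeg β (pos⇒nonNeg e>0)))

      falls : Pos (α * β) → FallsOn
      falls αβ>0 {px , py} {qx , qy} hp hq dx dy = square-absurd αβ>0 dx dy (null-pointwise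
        (solve 7 (λ a b c px py qx qy → a :* b :* (qx :- px) :+ b :* b :* (qy :- py) ⊜
            b :* (a :* qx :+ b :* qy :- c) :- b :* (a :* px :+ b :* py :- c)) (λ _ → refl)
          α β γ px py qx qy)
        (null-- (null-* β hq) (null-* β hp)))

      rises : Pos (- (α * β)) → RisesOn
      rises αβ<0 {px , py} {qx , qy} hp hq dx dy = square-absurd αβ<0 dx dy (null-pointwise
        (solve 7 (λ a b c px py qx qy → (:- (a :* b)) :* (qx :- px) :+ b :* b :* (py :- qy) ⊜
            b :* (a :* px :+ b :* py :- c) :- b :* (a :* qx :+ b :* qy :- c)) (λ _ → refl)
          α β γ px py qx qy)
        (null-- (null-* β hp) (null-* β hq)))

      -- If both coordinates changed, the vanishing of one coefficient would entail that of the
      -- other, against `nondegenerate`.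
      axisParallel : Null (α * β) → RisesOn
      axisParallel αβ≈0 {px , py} {qx , qy} hp hq dx dy = nondegenerate (null⇒≈0 α≈0 , null⇒≈0 β≈0)
        where
        α≈0 : Null α
        α≈0 = null-stable λ α≉0 → α≉0 (null-cancelʳ {α} {qx - px} (null-pointwise
          (solve 7 (λ a b c px py qx qy → a :* (qx :- px) ⊜
              ((a :* qx :+ b :* qy :- c) :- (a :* px :+ b :* py :- c)) :+ (py :- qy) :* b) (λ _ → refl)
            α β γ px py qx qy)
          (null-+ (null-- hq hp) (null-* (py - qy) (null-cancel αβ≈0 α≉0)))) (pos⇒¬null dx))
        β≈0 : Null β
        β≈0 = null-cancelʳ {β} {py - qy} (null-pointwise
          (solve 7 (λ a b c px py qx qy → b :* (py :- qy) ⊜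
              ((a :* px :+ b :* py :- c) :- (a :* qx :+ b :* qy :- c)) :+ (qx :- px) :* a) (λ _ → refl)
            α β γ px py qx qy)
          (null-+ (null-- hp hq) (null-* (qx - px) α≈0))) (pos⇒¬null dy)

    -- The sign of αβ cannot be computed, but refuting both alternatives refutes both signs, and the
    -- remaining case αβ = 0 also rises.
    ¬¬risesOrFalls : ¬ ¬ (RisesOn ⊎ FallsOn)
    ¬¬risesOrFalls k = k (inj₁ (axisParallel (¬pos⇒null (α * β)
      (λ p → k (inj₂ (falls p))) (λ p → k (inj₁ (rises p))))))

  -- The normal is q - p turned by a right angle, so that incidence of a third point is, up to sign,
  -- the equation in `Solution`.
  lineThrough : ∀ p q → p ≉ₚ q → Line
  lineThrough (a₁ , a₂) (b₁ , b₂) p≉q = record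
    { α = b₂ - a₂
    ; β = - (b₁ - a₁)
    ; γ = (b₂ - a₂) * a₁ + - (b₁ - a₁) * a₂
    ; nondegenerate = λ (h₂ , h₁) → p≉q
        ( null⇒≈ {a₁} {b₁} (null-pointwise {x = - (b₁ - a₁)}
            (solve 2 (λ a b → a :- b ⊜ :- (b :- a)) (λ _ → refl) a₁ b₁) (≈0⇒null h₁))
        , null⇒≈ {a₂} {b₂} (null-pointwise {x = - (b₂ - a₂)}
            (solve 2 (λ a b → a :- b ⊜ :- (b :- a)) (λ _ → refl) a₂ b₂) (null-neg (≈0⇒null h₂))) )
    }

  solution⇒collinear : ∀ {a₁ a₂ b₁ b₂ c₁ c₂} → (a₁ , a₂) ≉ₚ (b₁ , b₂) →
    (b₁ D.- a₁) D.* (c₂ D.- a₂) ≈ (c₁ D.- a₁) D.* (b₂ D.- a₂) →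
    Collinear (a₁ , a₂) (b₁ , b₂) (c₁ , c₂)
  solution⇒collinear {a₁} {a₂} {b₁} {b₂} {c₁} {c₂} a≉b h = ℓ ,
    onLine⇒liesOn ℓ (null-pointwise
      (solve 4 (λ a₁ a₂ b₁ b₂ → (b₂ :- a₂) :* a₁ :+ (:- (b₁ :- a₁)) :* a₂ :-
          ((b₂ :- a₂) :* a₁ :+ (:- (b₁ :- a₁)) :* a₂) ⊜ :0) (λ _ → refl) a₁ a₂ b₁ b₂)
      null-0) ,
    onLine⇒liesOn ℓ (null-pointwise
      (solve 4 (λ a₁ a₂ b₁ b₂ → (b₂ :- a₂) :* b₁ :+ (:- (b₁ :- a₁)) :* b₂ :-
          ((b₂ :- a₂) :* a₁ :+ (:- (b₁ :- a₁)) :* a₂) ⊜ :0) (λ _ → refl) a₁ a₂ b₁ b₂)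
      null-0) ,
    onLine⇒liesOn ℓ (null-pointwise
      (solve 6 (λ a₁ a₂ b₁ b₂ c₁ c₂ → (b₂ :- a₂) :* c₁ :+ (:- (b₁ :- a₁)) :* c₂ :-
          ((b₂ :- a₂) :* a₁ :+ (:- (b₁ :- a₁)) :* a₂) ⊜
          :- ((b₁ :- a₁) :* (c₂ :- a₂) :- (c₁ :- a₁) :* (b₂ :- a₂))) (λ _ → refl)
        a₁ a₂ b₁ b₂ c₁ c₂)
      (null-neg (≈⇒null {(b₁ - a₁) * (c₂ - a₂)} {(c₁ - a₁) * (b₂ - a₂)}
        (subst₂ _≈_ (sym (product≡ b₁ a₁ c₂ a₂)) (sym (product≡ c₁ a₁ b₂ a₂)) h))))
    where
    ℓ = lineThrough (a₁ , a₂) (b₁ , b₂) a≉b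
    product≡ : ∀ p q r s → (p - q) * (r - s) ≡ (p D.- q) D.* (r D.- s)
    product≡ p q r s = trans (*≡ (p - q) (r - s))
      (cong₂ D._*_ {p - q} {p D.- q} {r - s} {r D.- s} (-≡ p q) (-≡ r s))

-- Classical reasoning about finite sets of reals

module Enumerations where
  import Defs as D
  open import Defs
    using (ℝ; Point; Line; FiniteSet; elements; distinct; ∣_∣; _≈_; ℝ-setoid; Triple; _≉ₚ_; Collinear)
  open RealGeometry hiding (_+_; _*_; _-_; -_; 0ℝ)
  open GridLines
  open import Data.Nat.Base using (ℕ; suc; _+_; s≤s⁻¹)
  open import Data.Nat.Properties using (+-suc)
  open import Data.Fin.Base as Fin using (Fin; zero; suc)
  import Data.Fin.Properties as Fin
  open import Data.List.Base using (List; []; _∷_; length; lookup)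
  open import Data.List.Membership.Propositional.Properties using (∈-lookup)
  open import Data.List.Relation.Binary.Permutation.Propositional
    using (_↭_; ↭-refl; ↭-sym; ↭-trans; prep; swap)
  open import Data.List.Relation.Binary.Permutation.Propositional.Properties
    using (↭-length; All-resp-↭; Any-resp-↭)
  open import Data.List.Relation.Unary.All as All using (All; []; _∷_)
  open import Data.List.Relation.Unary.All.Properties using (¬Any⇒All¬)
  open import Data.List.Relation.Unary.Any as Any using (Any; here; there)
  open import Data.List.Relation.Unary.Any.Properties using (lookup-index)
  open import Data.List.Relation.Unary.AllPairs as AllPairs using (AllPairs; []; _∷_)
  import Data.List.Relation.Unary.Unique.Setoid as SetoidUnique
  open import Data.List.Relation.Unary.Unique.Propositional using (Unique)
  open import Data.Product.Base using (Σ-syntax; _×_; _,_; proj₁; proj₂; ∃-syntax)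
  open import Data.Sum.Base using (_⊎_; inj₁; inj₂)
  open import Level using (Level; 0ℓ)
  open import Relation.Binary.Bundles using (Setoid)
  open import Relation.Binary.PropositionalEquality
    using (_≡_; _≢_; refl; sym; trans; cong; cong₂)
  open import Relation.Binary.Definitions using (tri<; tri≈; tri>)
  open import Relation.Nullary.Decidable using (Dec; yes; no; ¬¬-excluded-middle)
  open import Relation.Nullary.Negation using (¬_; contradiction)

  private
    variable
      ℓ₁ ℓ₂ : Level
      A B : Set ℓ₁

  -- The double-negation monad: a `do` block is a classical argument, to be discharged at a
  -- decidable conclusion.
  return : A → ¬ ¬ A
  return a k = k a

  infixl 1 _>>=_
  _>>=_ : {A : Set ℓ₁} {B : Set ℓ₂} → ¬ ¬ A → (A → ¬ ¬ B) → ¬ ¬ B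
  (m >>= f) k = m λ a → f a k

  -- Double negation commutes with a universal quantifier here because the domain is finite.
  ¬¬-∀Fin : ∀ {n} {P : Fin n → Set} → (∀ i → ¬ ¬ P i) → ¬ ¬ (∀ i → P i)
  ¬¬-∀Fin {0}     f = return λ ()
  ¬¬-∀Fin {suc n} f = do
    p  ← f zero
    ps ← ¬¬-∀Fin (λ i → f (suc i))
    return λ { zero → p ; (suc i) → ps i }

  ¬¬-∀Pt : ∀ {n} {P : Pt n → Set} → (∀ p → ¬ ¬ P p) → ¬ ¬ (∀ p → P p)
  ¬¬-∀Pt f = do
    g ← ¬¬-∀Fin λ i → ¬¬-∀Fin λ j → f (i , j)
    return λ (i , j) → g i j

  ¬¬-All : ∀ {X : Set} {P Q : X → Set} → (∀ {x} → P x → ¬ ¬ Q x) → ∀ {xs} → All P xs → ¬ ¬ All Q xs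
  ¬¬-All f []       = return []
  ¬¬-All f (p ∷ ps) = do
    q  ← f p
    qs ← ¬¬-All f ps
    return (q ∷ qs)

  -- Sorting and ranks

  Sorted : List ℝ → Set
  Sorted = AllPairs _<_

  insert : ∀ x {ys} → Sorted ys → All (λ y → ¬ x ≈ y) ys →
           ¬ ¬ (∃[ zs ] (Sorted zs × zs ↭ x ∷ ys))
  insert x {[]}     []       []        = return (x ∷ [] , [] ∷ [] , ↭-refl)
  insert x {y ∷ ys} (h ∷ hs) (x≉y ∷ x≉ys) = ≉⇒¬¬<> {x} {y} x≉y >>= λ where
    (inj₁ x<y) → return (x ∷ y ∷ ys , (x<y ∷ All.map (<-trans x<y) h) ∷ h ∷ hs , ↭-refl)
    (inj₂ y<x) → insert x hs x≉ys >>= λ (zs , zs-sorted , zs↭) → return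
      ( y ∷ zs , All-resp-↭ (↭-sym zs↭) (y<x ∷ h) ∷ zs-sorted
      , ↭-trans (prep y zs↭) (swap y x ↭-refl) )

  sort : ∀ {xs} → SetoidUnique.Unique ℝ-setoid xs → ¬ ¬ (∃[ ys ] (Sorted ys × ys ↭ xs))
  sort []           = return ([] , [] , ↭-refl)
  sort {x ∷ _} (x∉xs ∷ u) = do
    (ys , ys-sorted , ys↭xs) ← sort u
    (zs , zs-sorted , zs↭)   ← insert x ys-sorted (All-resp-↭ (↭-sym ys↭xs) x∉xs)
    return (zs , zs-sorted , ↭-trans zs↭ (prep x ys↭xs))

  lookup-< : ∀ {xs} → Sorted xs → ∀ {i j} → i Fin.< j → lookup xs i < lookup xs j
  lookup-< (h ∷ _)  {zero}  {suc j} _   = All.lookup h (∈-lookup j)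
  lookup-< (_ ∷ hs) {suc i} {suc j} i<j = lookup-< hs (s≤s⁻¹ i<j)

  -- Ranks in increasing order stand for the reals, which gives grid points a decidable equality and
  -- turns monotone lines into monotone relations on indices.
  record Enumeration (xs : List ℝ) (n : ℕ) : Set where
    field
      at         : Fin n → ℝ
      increasing : ∀ {i j} → i Fin.< j → at i < at j
      index      : ∀ x → x D.∈ xs → ∃[ i ] x ≈ at i

    point : Pt n → Point
    point (i , j) = at i , at j

    code : ∀ {x y} → x D.∈ xs → y D.∈ xs → ∃[ p ] ≈ₚ._≈_ (x , y) (point p)
    code {x} {y} x∈ y∈ = let (i , x≈) = index x x∈ ; (j , y≈) = index y y∈ in (i , j) , (x≈ , y≈)

    at-injective : ∀ {i j} → at i ≈ at j → i ≡ j
    at-injective {i} {j} h with Fin.<-cmp i j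
    ... | tri< i<j _ _ = contradiction (≈⇒null (≈.sym {at i} {at j} h)) (pos⇒¬null (increasing i<j))
    ... | tri≈ _ i≡j _ = i≡j
    ... | tri> _ _ j<i = contradiction (≈⇒null {at i} {at j} h) (pos⇒¬null (increasing j<i))

    point-injective : ∀ {p q} → p ≢ q → point p ≉ₚ point q
    point-injective p≢q (h₁ , h₂) = p≢q (cong₂ _,_ (at-injective h₁) (at-injective h₂))

  ¬¬enumeration : ∀ S → ¬ ¬ Enumeration (elements S) ∣ S ∣
  ¬¬enumeration S = do
    (ys , ys-sorted , ys↭) ← sort (distinct S)
    return (fromSorted (↭-length ys↭) ys-sorted (λ _ → Any-resp-↭ (↭-sym ys↭)))
    where
    fromSorted : ∀ {ys n} → length ys ≡ n → Sorted ys →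
                 (∀ x → x D.∈ elements S → x D.∈ ys) → Enumeration (elements S) n
    fromSorted {ys} refl ys-sorted ⊆ys = record
      { at         = lookup ys
      ; increasing = lookup-< ys-sorted
      ; index      = λ x x∈ → Any.index (⊆ys x x∈) , lookup-index (⊆ys x x∈)
      }

  -- Coding and splitting lists of distinct elements

  module _ (S : Setoid 0ℓ 0ℓ) where
    private
      module S = Setoid S
      open SetoidUnique S using () renaming (Unique to UniqueS)

    -- The codes are distinct because a repeated code would identify two entries of `us`; the
    -- equality of the setoid is never decided.
    choose : ∀ {Z : Set} {Code : S.Carrier → Z → Set} {G : Z → Set} →
      (∀ {u v z} → Code u z → Code v z → u S.≈ v) →
      ∀ {us} → UniqueS us → All (λ u → ∃[ z ] (Code u z × G z)) us →
      ∃[ zs ] (Unique zs × length zs ≡ length us × All G zs)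
    choose {Z} {Code} {G} code-injective {us} us-unique codes =
      codeList codes , unique us-unique codes , length≡ codes , all codes
      where
      codeList : ∀ {us} → All (λ u → ∃[ z ] (Code u z × G z)) us → List Z
      codeList []             = []
      codeList ((z , _) ∷ cs) = z ∷ codeList cs
      length≡ : ∀ {us} (cs : All _ us) → length (codeList cs) ≡ length us
      length≡ []       = refl
      length≡ (_ ∷ cs) = cong suc (length≡ cs)
      all : ∀ {us} (cs : All _ us) → All G (codeList cs)
      all []                 = []
      all ((_ , _ , g) ∷ cs) = g ∷ all cs
      fresh : ∀ {u z us} → Code u z → All (λ v → ¬ u S.≈ v) us → (cs : All _ us) → All (z ≢_) (codeList cs)
      fresh c []           []                = []
      fresh c (u≉v ∷ u≉vs) ((_ , d , _) ∷ cs) =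
        (λ { refl → u≉v (code-injective c d) }) ∷ fresh c u≉vs cs
      unique : ∀ {us} → UniqueS us → (cs : All _ us) → Unique (codeList cs)
      unique []        []                = []
      unique (u∉us ∷ us) ((_ , c , _) ∷ cs) = fresh c u∉us cs ∷ unique us cs

    Split : (P Q : S.Carrier → Set) → List S.Carrier → Set
    Split P Q us = ∃[ vs ] ∃[ ws ] (length us ≡ length vs + length ws ×
      (UniqueS vs × All P vs) × (UniqueS ws × All Q ws))

    split : ∀ {P Q : S.Carrier → Set} {us} → UniqueS us → All (λ u → P u ⊎ Q u) us → Split P Q us
    split {P} {Q} u h = let (vs , ws , eq , x , y , _) = go u h in vs , ws , eq , x , y
      where
      go : ∀ {us} → UniqueS us → All (λ u → P u ⊎ Q u) us →
        ∃[ vs ] ∃[ ws ] (length us ≡ length vs + length ws ×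
          (UniqueS vs × All P vs) × (UniqueS ws × All Q ws) ×
          -- The induction also carries that whatever is fresh for the whole list is fresh for both
          -- parts; this keeps each part free of repetitions.
          (∀ {u} → All (λ v → ¬ u S.≈ v) us → All (λ v → ¬ u S.≈ v) vs × All (λ v → ¬ u S.≈ v) ws))
      go [] [] = [] , [] , refl , ([] , []) , ([] , []) , λ _ → [] , []
      go (u∉ ∷ us) (c ∷ cs) with go us cs
      go {u ∷ _} (u∉ ∷ us) (inj₁ p ∷ cs) | vs , ws , eq , (uv , pv) , (uw , qw) , sub =
        u ∷ vs , ws , cong suc eq , (proj₁ (sub u∉) ∷ uv , p ∷ pv) , (uw , qw) ,
        λ { (h ∷ hs) → h ∷ proj₁ (sub hs) , proj₂ (sub hs) }
      go {u ∷ _} (u∉ ∷ us) (inj₂ q ∷ cs) | vs , ws , eq , (uv , pv) , (uw , qw) , sub =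
        vs , u ∷ ws , trans (cong suc eq) (sym (+-suc (length vs) (length ws))) ,
        (uv , pv) , (proj₂ (sub u∉) ∷ uw , q ∷ qw) ,
        λ { (h ∷ hs) → proj₁ (sub hs) , h ∷ proj₂ (sub hs) }

  -- Covering the triples by lines

  module _ {xs n} (e : Enumeration xs n) where
    open Enumeration e

    -- The data for an `Incidence`. They cannot be computed from a line, so each line carries them
    -- along.
    Decided : Line → Set
    Decided ℓ = (∀ p → Dec (point p onLine ℓ)) ×
      (Increasing (λ p → point p onLine ℓ) ⊎ Decreasing (λ p → point p onLine ℓ))

    ¬¬decided : ∀ ℓ → ¬ ¬ Decided ℓ
    ¬¬decided ℓ = do
      on? ← ¬¬-∀Pt (λ p → ¬¬-excluded-middle)
      r   ← ¬¬risesOrFalls ℓ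
      return (on? , indexed r)
      where
      indexed : RisesOn ℓ ⊎ FallsOn ℓ → _
      indexed (inj₁ rises) = inj₁ λ {p} {q} hp hq i<j j<i →
        rises {point p} {point q} hp hq (increasing i<j) (increasing j<i)
      indexed (inj₂ falls) = inj₂ λ {p} {q} hp hq i<j j<i →
        falls {point p} {point q} hp hq (increasing i<j) (increasing j<i)

  module DecidedLines {A₁ A₂ A₃ : FiniteSet}
    (e₁ : Enumeration (elements A₁) ∣ A₁ ∣) (e₂ : Enumeration (elements A₂) ∣ A₂ ∣)
    (e₃ : Enumeration (elements A₃) ∣ A₃ ∣) where

    open Enumeration e₁ using () renaming (point to point₁; point-injective to point-injective₁) public
    open Enumeration e₂ using () renaming (point to point₂; point-injective to point-injective₂) public
    open Enumeration e₃ using () renaming (point to point₃; point-injective to point-injective₃) public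

    DecidedLine : Set
    DecidedLine = Σ[ ℓ ∈ Line ] (Decided e₁ ℓ × Decided e₂ ℓ × Decided e₃ ℓ)

    I₁ : Incidence DecidedLine ∣ A₁ ∣
    I₁ = record
      { On = λ L p → point₁ p onLine proj₁ L
      ; on? = λ (_ , (d , _) , _) → d ; monotone = λ (_ , (_ , m) , _) → m }

    I₂ : Incidence DecidedLine ∣ A₂ ∣
    I₂ = record
      { On = λ L p → point₂ p onLine proj₁ L
      ; on? = λ (_ , _ , (d , _) , _) → d ; monotone = λ (_ , _ , (_ , m) , _) → m }

    I₃ : Incidence DecidedLine ∣ A₃ ∣
    I₃ = record
      { On = λ L p → point₃ p onLine proj₁ L
      ; on? = λ (_ , _ , _ , (d , _)) → d ; monotone = λ (_ , _ , _ , (_ , m)) → m }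

    -- Lines are compared by inclusion of their points, in one direction; by `two-points⇒⊆` this
    -- already excludes two distinct common points, whatever the coefficients.
    _⊈_ : DecidedLine → DecidedLine → Set
    L ⊈ L′ = ¬ (∀ p → p onLine proj₁ L → p onLine proj₁ L′)

    Covers : List DecidedLine → Triple → Set
    Covers Ls (u₁ , u₂ , u₃) =
      Any (λ L → u₁ onLine proj₁ L × u₂ onLine proj₁ L × u₃ onLine proj₁ L) Ls

    -- A line is added only if no line kept so far contains it; otherwise the containing line covers
    -- its triple.
    ¬¬cover : ∀ {us} → All (λ (u₁ , u₂ , u₃) → Collinear u₁ u₂ u₃) us →
              ¬ ¬ (∃[ Ls ] (AllPairs _⊈_ Ls × All (Covers Ls) us))
    ¬¬cover [] = return ([] , [] , [])
    ¬¬cover {(u₁ , u₂ , u₃) ∷ us} ((ℓ , h₁ , h₂ , h₃) ∷ hs) = do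
      (Ls , Ls-distinct , Ls-covers) ← ¬¬cover hs
      yes known ← ¬¬-excluded-middle {A = Any (λ L → ∀ p → p onLine ℓ → p onLine proj₁ L) Ls}
        where
        no new → do
          d₁ ← ¬¬decided e₁ ℓ
          d₂ ← ¬¬decided e₂ ℓ
          d₃ ← ¬¬decided e₃ ℓ
          return ( (ℓ , d₁ , d₂ , d₃) ∷ Ls , ¬Any⇒All¬ Ls new ∷ Ls-distinct
                 , here (on₁ , on₂ , on₃) ∷ All.map there Ls-covers )
      return (Ls , Ls-distinct , Any.map (λ ⊆L → ⊆L u₁ on₁ , ⊆L u₂ on₂ , ⊆L u₃ on₃) known ∷ Ls-covers)
      where
      on₁ = liesOn⇒onLine {u₁} ℓ h₁
      on₂ = liesOn⇒onLine {u₂} ℓ h₂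
      on₃ = liesOn⇒onLine {u₃} ℓ h₃

    ⊈-separated : ∀ {L L′} → L ⊈ L′ → ∀ {p q} → p ≉ₚ q →
      p onLine proj₁ L → q onLine proj₁ L → p onLine proj₁ L′ → ¬ q onLine proj₁ L′
    ⊈-separated {ℓ , _} {ℓ′ , _} L⊈L′ {p} {q} p≉q pℓ qℓ pℓ′ qℓ′ =
      L⊈L′ (two-points⇒⊆ ℓ ℓ′ {p} {q} p≉q pℓ qℓ pℓ′ qℓ′)

-- From real triples to the bounds, with the degenerate triples

module Bounds where
  open FiniteSums
  open GridLines
  open TripleCounting
  open RealGeometry using (module ≈ₚ; _onLine_; onLine-resp; solution⇒collinear)
  open Enumerations
  open import Defs
    using (Point; FiniteSet; elements; ∣_∣; Triple; Triple-setoid; _≉ₚ_; _∈²_;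
      ProperCollinear; Solution; Bounded; _≤#_)
  open import Data.Nat.Base using (>-nonZero; _+_; _*_; _∸_; _^_; _⊔_; _≤_; z≤n; s≤s)
  open import Data.Nat.Properties
  open import Data.Nat.Logarithm using (⌊log₂_⌋; ⌊log₂⌋-mono-≤; ⌊log₂[2^n]⌋≡n)
  open import Data.Nat.Tactic.RingSolver using (solve-∀)
  open import Data.List.Base using (List; length; cartesianProduct)
  open import Data.List.Membership.Propositional.Properties using (∈-cartesianProduct⁺)
  open import Data.List.Relation.Unary.All as All using (All)
  import Data.List.Relation.Unary.Any as Any
  import Data.List.Relation.Unary.AllPairs as AllPairs
  import Data.List.Relation.Unary.Unique.Setoid as SetoidUnique
  open import Data.Product.Base using (_×_; _,_; proj₁; proj₂; ∃-syntax)
  open import Data.Sum.Base using (_⊎_; inj₁; inj₂)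
  open import Relation.Binary.Bundles using (Setoid)
  open import Relation.Binary.PropositionalEquality
    using (_≡_; refl; sym; trans; cong; cong₂; subst)
  open import Relation.Nullary.Decidable
    using (Dec; yes; no; decidable-stable; ¬¬-excluded-middle)
  open import Relation.Nullary.Negation using (¬_)

  1≤log₂[2+_] : ∀ n → 1 ≤ ⌊log₂ (2 + n) ⌋
  1≤log₂[2+ n ] = subst (_≤ ⌊log₂ (2 + n) ⌋) (⌊log₂[2^n]⌋≡n 1)
    (⌊log₂⌋-mono-≤ (s≤s (s≤s (z≤n {n}))))

  Unique₃ : List Triple → Set
  Unique₃ = SetoidUnique.Unique Triple-setoid

  module _ (A₁ A₂ A₃ : FiniteSet) where
    private
      a = ∣ A₁ ∣
      b = ∣ A₂ ∣
      c = ∣ A₃ ∣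
      N = a ⊔ b ⊔ c
      L = ⌊log₂ (2 + N) ⌋
      D = a * a * a * (b * b * b * b * b) * (c * c * c * c)

      1≤L : 1 ≤ L
      1≤L = 1≤log₂[2+ N ]

      log≤ : ∀ {n} → n ≤ N → 2 + ⌊log₂ n ⌋ ≤ 3 * L
      log≤ {n} n≤N = ≤-trans
        (+-mono-≤ (*-monoʳ-≤ 2 1≤L) (⌊log₂⌋-mono-≤ (≤-trans n≤N (m≤n+m N 2))))
        (≤-reflexive (e L))
        where
        e : ∀ L → 2 * L + L ≡ 3 * L
        e = solve-∀

    proper-cube≤ : a ≤ b → b ≤ c → ∀ {us} → Unique₃ us → All (ProperCollinear A₁ A₂ A₃) us →
      length us * length us * length us ≤ constant * L * (constant * L) * (constant * L) * D
    proper-cube≤ a≤b b≤c {us} us-unique proper = decidable-stable (_ ≤? _) (do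
        e₁ ← ¬¬enumeration A₁
        e₂ ← ¬¬enumeration A₂
        e₃ ← ¬¬enumeration A₃
        let open DecidedLines {A₁} {A₂} {A₃} e₁ e₂ e₃
        distinct? ← ¬¬-∀Pt (λ p → ¬¬-∀Pt (λ q → ¬¬-excluded-middle {A = point₁ p ≉ₚ point₂ q}))
        cover ← ¬¬cover {us} (All.map (λ (_ , _ , col) → col) proper)
        return (conclude e₁ e₂ e₃ distinct? cover))
      where
      module _ (e₁ : Enumeration (elements A₁) a) (e₂ : Enumeration (elements A₂) b)
        (e₃ : Enumeration (elements A₃) c) where
        open DecidedLines {A₁} {A₂} {A₃} e₁ e₂ e₃

        module _ (distinct? : ∀ p q → Dec (point₁ p ≉ₚ point₂ q)) where
          module T = CollinearTriples I₁ I₂ I₃ distinct?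

          Code : Triple → Pt a × Pt b × Pt c → Set
          Code (u₁ , u₂ , u₃) (p , q , r) =
            ≈ₚ._≈_ u₁ (point₁ p) × ≈ₚ._≈_ u₂ (point₂ q) × ≈ₚ._≈_ u₃ (point₃ r)

          Code-injective : ∀ {u v z} → Code u z → Code v z → Setoid._≈_ Triple-setoid u v
          Code-injective {u₁ , u₂ , u₃} {v₁ , v₂ , v₃} {p , q , r} (h₁ , h₂ , h₃) (k₁ , k₂ , k₃) =
            join {u₁} {v₁} {point₁ p} h₁ k₁ , join {u₂} {v₂} {point₂ q} h₂ k₂ ,
            join {u₃} {v₃} {point₃ r} h₃ k₃
            where
            join : ∀ {u v w : Point} → ≈ₚ._≈_ u w → ≈ₚ._≈_ v w → ≈ₚ._≈_ u v
            join {u} {v} {w} h k = ≈ₚ.trans {u} {w} {v} h (≈ₚ.sym {v} {w} k)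

          transport : ∀ {u₁ u₂ u₃ p q r} (L : DecidedLine) →
            ≈ₚ._≈_ u₁ (point₁ p) → ≈ₚ._≈_ u₂ (point₂ q) → ≈ₚ._≈_ u₃ (point₃ r) →
            u₁ onLine proj₁ L × u₂ onLine proj₁ L × u₃ onLine proj₁ L →
            point₁ p onLine proj₁ L × point₂ q onLine proj₁ L × point₃ r onLine proj₁ L
          transport {u₁} {u₂} {u₃} {p} {q} {r} (ℓ , _) h₁ h₂ h₃ (o₁ , o₂ , o₃) =
            onLine-resp {u₁} {point₁ p} ℓ h₁ o₁ ,
            onLine-resp {u₂} {point₂ q} ℓ h₂ o₂ ,
            onLine-resp {u₃} {point₃ r} ℓ h₃ o₃

          encode : ∀ {Ls u} → ProperCollinear A₁ A₂ A₃ u × Covers Ls u →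
                   ∃[ z ] (Code u z × T.OnCommonLine Ls z)
          encode {u = u₁ , u₂ , u₃} (((((x₁ , y₁) , (x₂ , y₂) , (x₃ , y₃)) , (u₁≉u₂ , _) , _)) , covered) =
            let (p , h₁) = Enumeration.code e₁ {proj₁ u₁} {proj₂ u₁} x₁ y₁
                (q , h₂) = Enumeration.code e₂ {proj₁ u₂} {proj₂ u₂} x₂ y₂
                (r , h₃) = Enumeration.code e₃ {proj₁ u₃} {proj₂ u₃} x₃ y₃
            in (p , q , r) , (h₁ , h₂ , h₃) ,
               (λ p≈q → u₁≉u₂ (≈ₚ.trans {u₁} {point₁ p} {u₂} h₁
                  (≈ₚ.trans {point₁ p} {point₂ q} {u₂} p≈q (≈ₚ.sym {u₂} {point₂ q} h₂)))) ,
               Any.map (λ {L} → transport {u₁} {u₂} {u₃} {p} {q} {r} L h₁ h₂ h₃) covered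

          conclude : ∃[ Ls ] (AllPairs.AllPairs _⊈_ Ls × All (Covers Ls) us) →
            length us * length us * length us ≤ constant * L * (constant * L) * (constant * L) * D
          conclude (Ls , Ls-distinct , Ls-covers) with
            choose Triple-setoid {Code = Code} {G = T.OnCommonLine Ls}
              (λ {u} {v} {z} → Code-injective {u} {v} {z}) us-unique
              (All.zipWith encode (proper , Ls-covers))
          ... | zs , zs-unique , |zs|≡|us| , good =
            subst (λ t → t * t * t ≤ constant * L * (constant * L) * (constant * L) * D) |zs|≡|us|
              (T.#triples-cube≤ {L = L} a≤b b≤c 1≤L
                (log≤ (≤-trans (m≤m⊔n a b) (m≤m⊔n (a ⊔ b) c)))
                (log≤ (≤-trans (m≤n⊔m a b) (m≤m⊔n (a ⊔ b) c)))
                (log≤ (m≤n⊔m (a ⊔ b) c))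
                (AllPairs.map (λ {L} {L′} sep {p} {q} p≢q →
                  ⊈-separated {L} {L′} sep {point₁ p} {point₁ q} (point-injective₁ p≢q)) Ls-distinct)
                (AllPairs.map (λ {L} {L′} sep {p} {q} p≢q →
                  ⊈-separated {L} {L′} sep {point₂ p} {point₂ q} (point-injective₂ p≢q)) Ls-distinct)
                (AllPairs.map (λ {L} {L′} sep {p} {q} p≢q →
                  ⊈-separated {L} {L′} sep {point₃ p} {point₃ q} (point-injective₃ p≢q)) Ls-distinct)
                (AllPairs.map (λ {L} {L′} sep {p} {q} p≉q →
                  ⊈-separated {L} {L′} sep {point₁ p} {point₂ q} p≉q) Ls-distinct)
                zs-unique good)

    proper-bounded : a ≤ b → b ≤ c →
      Bounded constant 1 N (a ^ 3 * b ^ 5 * c ^ 4) 0 (ProperCollinear A₁ A₂ A₃)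
    proper-bounded a≤b b≤c t (us , us-unique , proper , refl) = begin
      (t ∸ K * 0) ^ 3                               ≤⟨ ^-monoˡ-≤ 3 (m∸n≤m t (K * 0)) ⟩
      t ^ 3                                         ≡⟨ e₁ t ⟩
      t * t * t                                     ≤⟨ proper-cube≤ a≤b b≤c us-unique proper ⟩
      constant * L * (constant * L) * (constant * L) * D ≡⟨ cong (λ k → k * k * k * D) (cong (constant *_) (*-identityʳ L)) ⟨
      K * K * K * D                                 ≡⟨ e₂ K a b c ⟩
      K ^ 3 * (a ^ 3 * b ^ 5 * c ^ 4)               ∎
      where
      open ≤-Reasoning
      K = constant * L ^ 1
      e₁ : ∀ t → t * (t * (t * 1)) ≡ t * t * t
      e₁ = solve-∀
      e₂ : ∀ k a b c → k * k * k * (a * a * a * (b * b * b * b * b) * (c * c * c * c)) ≡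
           k * (k * (k * 1)) * (a * (a * (a * 1)) * (b * (b * (b * (b * (b * 1))))) * (c * (c * (c * (c * 1)))))
      e₂ = solve-∀

  module _ (A B : FiniteSet) {P : Triple → Set} (u v : Triple → Point)
    (members : ∀ {t} → P t → u t ∈² A × v t ∈² B)
    (determined : ∀ {s t} → P s → P t → ≈ₚ._≈_ (u s) (u t) → ≈ₚ._≈_ (v s) (v t) →
                  Setoid._≈_ Triple-setoid s t) where

    -- A triple with two coinciding points is determined by two of its points, so it is coded by a
    -- pair of grid points.
    degenerate≤ : ∀ {ts} → Unique₃ ts → All P ts → length ts ≤ ∣ A ∣ * ∣ A ∣ * (∣ B ∣ * ∣ B ∣)
    degenerate≤ {ts} ts-unique ps = decidable-stable (_ ≤? _) (do
        e ← ¬¬enumeration A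
        f ← ¬¬enumeration B
        return (conclude e f))
      where
      module _ (e : Enumeration (elements A) ∣ A ∣) (f : Enumeration (elements B) ∣ B ∣) where
        open Enumeration e renaming (point to pointA; code to codeA) using ()
        open Enumeration f renaming (point to pointB; code to codeB) using ()

        -- `P t` belongs to the code because `determined` needs it to recover the triple.
        Code : Triple → Pt ∣ A ∣ × Pt ∣ B ∣ → Set
        Code t (p , q) = P t × ≈ₚ._≈_ (u t) (pointA p) × ≈ₚ._≈_ (v t) (pointB q)

        Code-injective : ∀ {s t z} → Code s z → Code t z → Setoid._≈_ Triple-setoid s t
        Code-injective {s} {t} {p , q} (ps , h , k) (pt , h′ , k′) = determined {s} {t} ps pt
          (≈ₚ.trans {u s} {pointA p} {u t} h (≈ₚ.sym {u t} {pointA p} h′))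
          (≈ₚ.trans {v s} {pointB q} {v t} k (≈ₚ.sym {v t} {pointB q} k′))

        -- The payload `1 ≤ 1` is what `length≤∑` asks for the constant function 1.
        encode : ∀ {t} → P t → ∃[ z ] (Code t z × 1 ≤ 1)
        encode {t} p =
          let ((x , y) , (x′ , y′)) = members p
              (i , h) = codeA {proj₁ (u t)} {proj₂ (u t)} x y
              (j , k) = codeB {proj₁ (v t)} {proj₂ (v t)} x′ y′
          in (i , j) , (p , h , k) , ≤-refl

        conclude : length ts ≤ ∣ A ∣ * ∣ A ∣ * (∣ B ∣ * ∣ B ∣)
        conclude with choose Triple-setoid {Code = Code} {G = λ _ → 1 ≤ 1}
          (λ {s} {t} {z} → Code-injective {s} {t} {z}) ts-unique (All.map encode ps)
        ... | zs , zs-unique , |zs|≡|ts| , ones = begin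
          length ts       ≡⟨ |zs|≡|ts| ⟨
          length zs       ≤⟨ length≤∑ ones ⟩
          ∑[ _ ∈ zs ] 1   ≤⟨ ∑-⊆ (λ _ → 1) zs-unique (λ {z} _ →
                               ∈-cartesianProduct⁺ (∈-pts (proj₁ z)) (∈-pts (proj₂ z))) ⟩
          ∑[ _ ∈ pairs ] 1 ≡⟨ trans (∑-const pairs 1) (*-identityʳ (length pairs)) ⟩
          length pairs     ≡⟨ length-cartesianProduct (pts ∣ A ∣) (pts ∣ B ∣) ⟩
          length (pts ∣ A ∣) * length (pts ∣ B ∣) ≡⟨ cong₂ _*_ (length-pts ∣ A ∣) (length-pts ∣ B ∣) ⟩
          ∣ A ∣ * ∣ A ∣ * (∣ B ∣ * ∣ B ∣) ∎
          where
          open ≤-Reasoning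
          pairs = cartesianProduct (pts ∣ A ∣) (pts ∣ B ∣)

  -- The three degenerate classes have at most 3E ≤ KE members, which truncated subtraction removes;
  -- what remains is at most `w`.
  absorb : ∀ {K E X t x y z w} → 3 ≤ K → t ≡ x + (y + (z + w)) → x ≤ E → y ≤ E → z ≤ E →
           (w ∸ K * 0) ^ 3 ≤ X → (t ∸ K * E) ^ 3 ≤ X
  absorb {K} {E} {X} {t} {x} {y} {z} {w} 3≤K t≡ x≤ y≤ z≤ w≤ = ≤-trans (^-monoˡ-≤ 3 remainder) w≤
    where
    open ≤-Reasoning
    regroup : ∀ E w → E + (E + (E + w)) ≡ 3 * E + w
    regroup = solve-∀
    remainder : t ∸ K * E ≤ w ∸ K * 0
    remainder = begin
      t ∸ K * E                 ≤⟨ ∸-mono (≤-reflexive t≡) (*-monoˡ-≤ E 3≤K) ⟩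
      x + (y + (z + w)) ∸ 3 * E ≤⟨ ∸-monoˡ-≤ (3 * E) (+-mono-≤ x≤ (+-mono-≤ y≤ (+-monoˡ-≤ w z≤))) ⟩
      E + (E + (E + w)) ∸ 3 * E ≡⟨ cong (_∸ 3 * E) (regroup E w) ⟩
      3 * E + w ∸ 3 * E         ≡⟨ m+n∸m≡n (3 * E) w ⟩
      w ∸ 0                     ≡⟨ cong (w ∸_) (*-zeroʳ K) ⟨
      w ∸ K * 0                 ∎

  module _ (A₁ A₂ A₃ : FiniteSet) where
    private
      a = ∣ A₁ ∣
      b = ∣ A₂ ∣
      c = ∣ A₃ ∣
      N = a ⊔ b ⊔ c

      -- Each class keeps the membership of two points that determine the triple. Only the
      -- coincidence of the first two points needs the third grid and produces the term a²c²; the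
      -- others give a²b².
      E₁₂ E₁₃ E₂₃ : Triple → Set
      E₁₂ (u₁ , u₂ , u₃) = (u₁ ∈² A₁ × u₃ ∈² A₃) × ≈ₚ._≈_ u₁ u₂
      E₁₃ (u₁ , u₂ , u₃) = (u₁ ∈² A₁ × u₂ ∈² A₂) × ≈ₚ._≈_ u₁ u₃
      E₂₃ (u₁ , u₂ , u₃) = (u₁ ∈² A₁ × u₂ ∈² A₂) × ≈ₚ._≈_ u₂ u₃

      square : ∀ {s t s′ t′ : Point} → ≈ₚ._≈_ s s′ → ≈ₚ._≈_ t t′ → ≈ₚ._≈_ s t → ≈ₚ._≈_ s′ t′
      square {s} {t} {s′} {t′} h k st = ≈ₚ.trans {s′} {s} {t′} (≈ₚ.sym {s} {s′} h) (≈ₚ.trans {s} {t} {t′} st k)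

      infix 4 _≈₃_
      _≈₃_ : Triple → Triple → Set
      _≈₃_ = Setoid._≈_ Triple-setoid

      determined₁₂ : ∀ {s t} → E₁₂ s → E₁₂ t → ≈ₚ._≈_ (proj₁ s) (proj₁ t) →
        ≈ₚ._≈_ (proj₂ (proj₂ s)) (proj₂ (proj₂ t)) → s ≈₃ t
      determined₁₂ {s₁ , s₂ , s₃} {t₁ , t₂ , t₃} (_ , h) (_ , k) x y =
        x , square {s₁} {t₁} {s₂} {t₂} h k x , y

      determined₁₃ : ∀ {s t} → E₁₃ s → E₁₃ t → ≈ₚ._≈_ (proj₁ s) (proj₁ t) →
        ≈ₚ._≈_ (proj₁ (proj₂ s)) (proj₁ (proj₂ t)) → s ≈₃ t
      determined₁₃ {s₁ , s₂ , s₃} {t₁ , t₂ , t₃} (_ , h) (_ , k) x y =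
        x , y , square {s₁} {t₁} {s₃} {t₃} h k x

      determined₂₃ : ∀ {s t} → E₂₃ s → E₂₃ t → ≈ₚ._≈_ (proj₁ s) (proj₁ t) →
        ≈ₚ._≈_ (proj₁ (proj₂ s)) (proj₁ (proj₂ t)) → s ≈₃ t
      determined₂₃ {s₁ , s₂ , s₃} {t₁ , t₂ , t₃} (_ , h) (_ , k) x y =
        x , y , square {s₂} {t₂} {s₃} {t₃} h k y

      #E₁₂≤ : ∀ {us} → Unique₃ us → All E₁₂ us → length us ≤ a * a * (c * c)
      #E₁₂≤ = degenerate≤ A₁ A₃ {E₁₂} proj₁ (λ u → proj₂ (proj₂ u)) proj₁
        (λ {s} {t} → determined₁₂ {s} {t})

      #E₁₃≤ : ∀ {us} → Unique₃ us → All E₁₃ us → length us ≤ a * a * (b * b)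
      #E₁₃≤ = degenerate≤ A₁ A₂ {E₁₃} proj₁ (λ u → proj₁ (proj₂ u)) proj₁
        (λ {s} {t} → determined₁₃ {s} {t})

      #E₂₃≤ : ∀ {us} → Unique₃ us → All E₂₃ us → length us ≤ a * a * (b * b)
      #E₂₃≤ = degenerate≤ A₁ A₂ {E₂₃} proj₁ (λ u → proj₁ (proj₂ u)) proj₁
        (λ {s} {t} → determined₂₃ {s} {t})

      -- If the first two points agree, both sides of the equation vanish and it is void; otherwise
      -- the line through them contains the third. Which points agree is asked classically.
      classify : ∀ {u} → Solution A₁ A₂ A₃ u → ¬ ¬ (E₁₂ u ⊎ E₁₃ u ⊎ E₂₃ u ⊎ ProperCollinear A₁ A₂ A₃ u)
      classify {(a₁ , a₂) , (b₁ , b₂) , (c₁ , c₂)} ((m₁ , m₂ , m₃) , eq) = do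
        no ≉₁₂ ← ¬¬-excluded-middle {A = ≈ₚ._≈_ (a₁ , a₂) (b₁ , b₂)}
          where yes h → return (inj₁ ((m₁ , m₃) , h))
        no ≉₁₃ ← ¬¬-excluded-middle {A = ≈ₚ._≈_ (a₁ , a₂) (c₁ , c₂)}
          where yes h → return (inj₂ (inj₁ ((m₁ , m₂) , h)))
        no ≉₂₃ ← ¬¬-excluded-middle {A = ≈ₚ._≈_ (b₁ , b₂) (c₁ , c₂)}
          where yes h → return (inj₂ (inj₂ (inj₁ ((m₁ , m₂) , h))))
        return (inj₂ (inj₂ (inj₂ ((m₁ , m₂ , m₃) , (≉₁₂ , ≉₁₃ , ≉₂₃) ,
          solution⇒collinear {a₁} {a₂} {b₁} {b₂} {c₁} {c₂} ≉₁₂ eq))))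

    private
      aacc≤ : a * a * (c * c) ≤ a ^ 2 * c ^ 2
      aacc≤ = ≤-reflexive (e a c)
        where
        e : ∀ a c → a * a * (c * c) ≡ a * (a * 1) * (c * (c * 1))
        e = solve-∀

      aabb≤ : b ≤ c → a * a * (b * b) ≤ a ^ 2 * c ^ 2
      aabb≤ b≤c = ≤-trans (*-monoʳ-≤ (a * a) (*-mono-≤ b≤c b≤c)) aacc≤

      addDegenerate : ∀ {K X} → 3 ≤ K → b ≤ c →
        (∀ t → t ≤# ProperCollinear A₁ A₂ A₃ → (t ∸ K * 0) ^ 3 ≤ X) →
        ∀ {us} → Unique₃ us →
        All (λ u → E₁₂ u ⊎ E₁₃ u ⊎ E₂₃ u ⊎ ProperCollinear A₁ A₂ A₃ u) us →
        (length us ∸ K * (a ^ 2 * c ^ 2)) ^ 3 ≤ X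
      addDegenerate {K} {X} 3≤K b≤c proper {us} us-unique classes
        with split Triple-setoid us-unique classes
      ... | u₁₂ , r₁ , |us| , (uniq₁₂ , h₁₂) , (v₁ , c₁) with split Triple-setoid v₁ c₁
      ... | u₁₃ , r₂ , |r₁| , (uniq₁₃ , h₁₃) , (v₂ , c₂) with split Triple-setoid v₂ c₂
      ... | u₂₃ , r₃ , |r₂| , (uniq₂₃ , h₂₃) , (v₃ , c₃) =
        absorb {K} {a ^ 2 * c ^ 2} {X} {length us} {length u₁₂} {length u₁₃} {length u₂₃} {length r₃} 3≤K
          (trans |us| (cong (length u₁₂ +_) (trans |r₁| (cong (length u₁₃ +_) |r₂|))))
          (≤-trans (#E₁₂≤ uniq₁₂ h₁₂) aacc≤)
          (≤-trans (#E₁₃≤ uniq₁₃ h₁₃) (aabb≤ b≤c))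
          (≤-trans (#E₂₃≤ uniq₂₃ h₂₃) (aabb≤ b≤c))
          (proper (length r₃) (r₃ , v₃ , c₃ , refl))

    -- The constant carries over unchanged: being at least 3, it absorbs the three degenerate
    -- classes into the additive term.
    proper⇒solution-bounded : ∀ {C k D} → 3 ≤ C → b ≤ c →
      Bounded C k N D 0 (ProperCollinear A₁ A₂ A₃) →
      Bounded C k N D (a ^ 2 * c ^ 2) (Solution A₁ A₂ A₃)
    proper⇒solution-bounded {C} {k} {D} 3≤C b≤c proper t (us , us-unique , solutions , refl) =
      decidable-stable ((length us ∸ C * L ^ k * (a ^ 2 * c ^ 2)) ^ 3 ≤? (C * L ^ k) ^ 3 * D) (do
        classes ← ¬¬-All (λ {u} → classify {u}) solutions
        return (addDegenerate {C * L ^ k} {(C * L ^ k) ^ 3 * D} 3≤K b≤c proper us-unique classes))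
      where
      L = ⌊log₂ (2 + N) ⌋
      3≤K : 3 ≤ C * L ^ k
      3≤K = *-mono-≤ 3≤C (m^n>0 L {{>-nonZero (1≤log₂[2+ N ])}} k)

open Bounds using (proper-bounded; proper⇒solution-bounded)
open TripleCounting using (constant; 3≤constant)
open import Defs
open import Data.Nat.Base using (ℕ; _≤_; _<_; _⊔_; _^_; z≤n; s≤s) renaming (_*_ to _·_)
open import Data.Nat.Properties using (≤-trans)
open import Data.Product.Base using (_×_; _,_; ∃-syntax)

mainTheorem1 : (∃[ C ] ∃[ c ] (0 < C × 0 < c ×
    (∀ (A₁ A₂ A₃ : FiniteSet) → ∣ A₁ ∣ ≤ ∣ A₂ ∣ → ∣ A₂ ∣ ≤ ∣ A₃ ∣ →
    Bounded C c (∣ A₁ ∣ ⊔ ∣ A₂ ∣ ⊔ ∣ A₃ ∣)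
    (∣ A₁ ∣ ^ 3 · ∣ A₂ ∣ ^ 5 · ∣ A₃ ∣ ^ 4)
    0
    (ProperCollinear A₁ A₂ A₃))))
    ×
    (∃[ C ] ∃[ c ] (0 < C × 0 < c ×
    (∀ (A₁ A₂ A₃ : FiniteSet) → ∣ A₁ ∣ ≤ ∣ A₂ ∣ → ∣ A₂ ∣ ≤ ∣ A₃ ∣ →
    Bounded C c (∣ A₁ ∣ ⊔ ∣ A₂ ∣ ⊔ ∣ A₃ ∣)
    (∣ A₁ ∣ ^ 3 · ∣ A₂ ∣ ^ 5 · ∣ A₃ ∣ ^ 4)
    (∣ A₁ ∣ ^ 2 · ∣ A₃ ∣ ^ 2)
    (Solution A₁ A₂ A₃))))
mainTheorem1 =
  -- The cubed bound contains three factors `lam`, each linear in the logarithm, so its cube root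
  -- contains one: the exponent is 1.
  (constant , 1 , 0<constant , s≤s z≤n , proper-bounded) ,
  (constant , 1 , 0<constant , s≤s z≤n , λ A₁ A₂ A₃ a≤b b≤c →
    proper⇒solution-bounded A₁ A₂ A₃ {constant} {1} {∣ A₁ ∣ ^ 3 · ∣ A₂ ∣ ^ 5 · ∣ A₃ ∣ ^ 4} 3≤constant b≤c
      (proper-bounded A₁ A₂ A₃ a≤b b≤c))
  where
  0<constant = ≤-trans (s≤s z≤n) 3≤constant
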